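{- Let $n\ge 2$. The largest part of the parking partition $(gt_n,eq_n,lt_n)$ equals the largest part of the tree-poset partition $(R_n^{\cdot<0},R_n^{0<\cdot<1},R_n^{\cdot>1})$, that is, $$\max(gt_n,eq_n,lt_n)=\max(R_n^{\cdot<0},R_n^{0<\cdot<1},R_n^{\cdot>1}).$$ Hence the sorted parking partition majorises the sorted tree-poset partition.
   Context: A parking function of length $n$ is a sequence $(a_1,\dots,a_n)$ of integers in $\{0,1,\dots,n-1\}$ whose weakly increasing rearrangement $(b_1,\dots,b_n)$ satisfies $b_i<i$ for all $i$. Let $gt_n$, $eq_n$, $lt_n$ be the numbers of parking functions of length $n$ with $a_1>a_2$, $a_1=a_2$, $a_1<a_2$ respectively. The Shi arrangement $\mathcal S_n$ in $\mathbb R^n$ consists of the hyperplanes $x_i-x_j=0$ and $x_i-x_j=1$ for $1\le i<j\le n$; its regions are the connected components of the complement of the union of these hyperplanes. Let $R_n^{\cdot<0}$, $R_n^{0<\cdot<1}$, $R_n^{\cdot>1}$ be the numbers of regions of $\mathcal S_n$ all of whose points satisfy $x_1-x_2<0$, $0<x_1-x_2<1$, $x_1-x_2>1$ respectively. (Each of the two triples has sum $(n+1)^{n-1}$.) For triples sorted in weakly decreasing order $\lambda_1\ge\lambda_2\ge\lambda_3$ and $\mu_1\ge\mu_2\ge\mu_3$, $\lambda$ majorises $\mu$ if $\lambda_1\ge\mu_1$, $\lambda_1+\lambda_2\ge\mu_1+\mu_2$ and $\lambda_1+\lambda_2+\lambda_3=\mu_1+\mu_2+\mu_3$. -}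

module Defs where

open import Data.Fin.Base as Fin using (Fin; toℕ)
open import Data.Fin.Patterns using (0F; 1F)
open import Data.Fin.Permutation using (Permutation′; _⟨$⟩ʳ_)
open import Data.List.Base using (List; []; _∷_)
open import Data.List.Relation.Binary.Permutation.Propositional using (_↭_)
open import Data.Nat.Base as ℕ using (ℕ)
import Data.Nat.Properties as ℕ
open import Data.Product.Base using (Σ; Σ-syntax; ∃-syntax; _×_; _,_; proj₁)
open import Data.Rational.Base as ℚ using (ℚ; 0ℚ; 1ℚ; ½)
import Data.Rational.Properties as ℚ
open import Data.Rational.Solver using (module +-*-Solver)
open import Data.Sum.Base using (_⊎_)
open import Function.Base using (_∘_)
open import Function.Bundles using (Inverse)
open import Level using (Level; 0ℓ)
open import Relation.Binary.Bundles using (Setoid)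
import Relation.Binary.Construct.On as On
open import Relation.Binary.Core using (_Preserves_⟶_)
open import Relation.Binary.PropositionalEquality
  using (_≡_; refl; sym; cong; subst; setoid; _→-setoid_)
open import Relation.Nullary.Negation using (¬_)
open import Relation.Unary using (Pred; _∈_; _⊆_; Satisfiable)
open import Relation.Unary.Relation.Binary.Equality using (≐-setoid)

private
  variable
    a ℓ p : Level
    n : ℕ

HasSize : Setoid a ℓ → ℕ → Set (a Level.⊔ ℓ)
HasSize S k = Inverse (setoid (Fin k)) S

-- Proofs of P are disregarded by the equality, so that an element
-- satisfying P is counted once.
infixl 5 _suchThat_

_suchThat_ : (S : Setoid a ℓ) → Pred (Setoid.Carrier S) p → Setoid (a Level.⊔ p) ℓ
S suchThat P = On.setoid S (proj₁ {B = P})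

-- Positions are numbered from 0 here, so the classical condition
-- b_i < i on b_1, …, b_n becomes b_i < i + 1.
IsParking : Pred (Fin n → Fin n) 0ℓ
IsParking {n} f = Σ[ π ∈ Permutation′ n ]
  let b = f ∘ (π ⟨$⟩ʳ_) in
  (b Preserves Fin._≤_ ⟶ Fin._≤_) ×
  (∀ i → toℕ (b i) ℕ.< ℕ.suc (toℕ i))

ParkingFunctions : ℕ → Setoid 0ℓ 0ℓ
ParkingFunctions n = (Fin n →-setoid Fin n) suchThat IsParking

-- A length n ≥ 2 is written 2 + m here and below, so that the first two
-- positions are 0F and 1F.
module _ (m : ℕ) where

  private
    PF = Setoid.Carrier (ParkingFunctions (2 ℕ.+ m))

  ParkGt ParkEq ParkLt : Pred PF 0ℓ
  ParkGt (f , _) = f 0F Fin.> f 1F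
  ParkEq (f , _) = f 0F ≡ f 1F
  ParkLt (f , _) = f 0F Fin.< f 1F

-- Represented by Cauchy sequences; equal reals may have different
-- representations.  Order, balls and regions do not depend on the choice.
record ℝ : Set where
  field
    seq    : ℕ → ℚ
    cauchy : ∀ ε → 0ℚ ℚ.< ε → ∃[ N ] (∀ k l → N ℕ.≤ k → N ℕ.≤ l →
             ℚ.∣ seq k ℚ.- seq l ∣ ℚ.< ε)

open ℝ

fromℚ : ℚ → ℝ
fromℚ q .seq _ = q
fromℚ q .cauchy ε 0<ε = 0 , λ _ _ _ _ →
  subst (ℚ._< ε) (sym (cong ℚ.∣_∣ (ℚ.+-inverseʳ q))) 0<ε

infixl 6 _-_

_-_ : ℝ → ℝ → ℝ
(x - y) .seq k = seq x k ℚ.- seq y k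
(x - y) .cauchy ε 0<ε
  with M , hx ← cauchy x (½ ℚ.* ε) (ℚ.*-monoʳ-<-pos ½ 0<ε)
     | N , hy ← cauchy y (½ ℚ.* ε) (ℚ.*-monoʳ-<-pos ½ 0<ε)
  = M ℕ.⊔ N , λ k l k≥ l≥ → begin-strict
    ℚ.∣ (seq x k ℚ.- seq y k) ℚ.- (seq x l ℚ.- seq y l) ∣
      ≡⟨ cong ℚ.∣_∣ (interchange (seq x k) (seq y k) (seq x l) (seq y l)) ⟩
    ℚ.∣ (seq x k ℚ.- seq x l) ℚ.- (seq y k ℚ.- seq y l) ∣
      ≤⟨ ℚ.∣p-q∣≤∣p∣+∣q∣ (seq x k ℚ.- seq x l) (seq y k ℚ.- seq y l) ⟩
    ℚ.∣ seq x k ℚ.- seq x l ∣ ℚ.+ ℚ.∣ seq y k ℚ.- seq y l ∣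
      <⟨ ℚ.+-mono-<
           (hx k l (ℕ.m⊔n≤o⇒m≤o M N k≥) (ℕ.m⊔n≤o⇒m≤o M N l≥))
           (hy k l (ℕ.m⊔n≤o⇒n≤o M N k≥) (ℕ.m⊔n≤o⇒n≤o M N l≥)) ⟩
    ½ ℚ.* ε ℚ.+ ½ ℚ.* ε
      ≡⟨ halves ε ⟩
    ε ∎
  where
  open ℚ.≤-Reasoning
  open +-*-Solver

  interchange : ∀ a b c d →
    (a ℚ.- b) ℚ.- (c ℚ.- d) ≡ (a ℚ.- c) ℚ.- (b ℚ.- d)
  interchange = solve 4 (λ a b c d →
    (a :- b) :- (c :- d) := (a :- c) :- (b :- d)) refl

  halves : ∀ e → ½ ℚ.* e ℚ.+ ½ ℚ.* e ≡ e
  halves = solve 1 (λ e → con ½ :* e :+ con ½ :* e := e) refl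

infix 4 _<_ _>_ _#_

_<_ _>_ _#_ : ℝ → ℝ → Set
x < y = ∃[ ε ] (0ℚ ℚ.< ε × ∃[ N ] (∀ k → N ℕ.≤ k → seq x k ℚ.+ ε ℚ.< seq y k))
x > y = y < x
x # y = x < y ⊎ y < x

0ℝ 1ℝ : ℝ
0ℝ = fromℚ 0ℚ
1ℝ = fromℚ 1ℚ

Point : ℕ → Set
Point n = Fin n → ℝ

-- Balls of the maximum norm, which gives the usual topology.
Ball : Point n → ℚ → Pred (Point n) 0ℓ
Ball x ε y = ∀ i → fromℚ (ℚ.- ε) < y i - x i × y i - x i < fromℚ ε

IsOpen : Pred (Point n) 0ℓ → Set
IsOpen A = ∀ x → x ∈ A → ∃[ ε ] (0ℚ ℚ.< ε × Ball x ε ⊆ A)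

Connected : Pred (Point n) 0ℓ → Set₁
Connected {n} C = (A B : Pred (Point n) 0ℓ) → IsOpen A → IsOpen B →
  (∀ x → x ∈ C → x ∈ A ⊎ x ∈ B) →
  (∀ x → x ∈ C → ¬ (x ∈ A × x ∈ B)) →
  ¬ ((∃[ x ] (x ∈ C × x ∈ A)) × (∃[ x ] (x ∈ C × x ∈ B)))

record IsComponentOf (U C : Pred (Point n) 0ℓ) : Set₁ where
  field
    inhabited : Satisfiable C
    within    : C ⊆ U
    connected : Connected C
    maximal   : (D : Pred (Point n) 0ℓ) →
                D ⊆ U → Connected D → C ⊆ D → D ⊆ C

-- Lying off a hyperplane is expressed by apartness, the constructive
-- form of inequality of reals.
ShiComplement : Pred (Point n) 0ℓ
ShiComplement x = ∀ i j → i Fin.< j → (x i - x j # 0ℝ) × (x i - x j # 1ℝ)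

Regions : ℕ → Setoid (Level.suc 0ℓ) 0ℓ
Regions n = ≐-setoid (Point n) 0ℓ suchThat IsComponentOf ShiComplement

module _ (m : ℕ) where

  private
    Region = Setoid.Carrier (Regions (2 ℕ.+ m))

  Below0 Between01 Above1 : Pred Region 0ℓ
  Below0    (C , _) = ∀ x → x ∈ C → x 0F - x 1F < 0ℝ
  Between01 (C , _) = ∀ x → x ∈ C → (0ℝ < x 0F - x 1F) × (x 0F - x 1F < 1ℝ)
  Above1    (C , _) = ∀ x → x ∈ C → x 0F - x 1F > 1ℝ

record Triple : Set where
  constructor ⟨_,_,_⟩
  field
    part₁ part₂ part₃ : ℕ

open Triple

toList : Triple → List ℕ
toList ⟨ x , y , z ⟩ = x ∷ y ∷ z ∷ []

largest : Triple → ℕ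
largest ⟨ x , y , z ⟩ = x ℕ.⊔ y ℕ.⊔ z

_SortedFormOf_ : Triple → Triple → Set
s SortedFormOf t =
  part₁ s ℕ.≥ part₂ s × part₂ s ℕ.≥ part₃ s × toList s ↭ toList t

_Majorises_ : Triple → Triple → Set
s Majorises t =
  part₁ s ℕ.≥ part₁ t ×
  part₁ s ℕ.+ part₂ s ℕ.≥ part₁ t ℕ.+ part₂ t ×
  part₁ s ℕ.+ part₂ s ℕ.+ part₃ s ≡ part₁ t ℕ.+ part₂ t ℕ.+ part₃ t

record IsParkingPartition (m : ℕ) (t : Triple) : Set where
  field
    gt : HasSize (ParkingFunctions (2 ℕ.+ m) suchThat ParkGt m) (part₁ t)
    eq : HasSize (ParkingFunctions (2 ℕ.+ m) suchThat ParkEq m) (part₂ t)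
    lt : HasSize (ParkingFunctions (2 ℕ.+ m) suchThat ParkLt m) (part₃ t)

record IsTreePosetPartition (m : ℕ) (t : Triple) : Set₁ where
  field
    below0    : HasSize (Regions (2 ℕ.+ m) suchThat Below0 m) (part₁ t)
    between01 : HasSize (Regions (2 ℕ.+ m) suchThat Between01 m) (part₂ t)
    above1    : HasSize (Regions (2 ℕ.+ m) suchThat Above1 m) (part₃ t)

{-# OPTIONS --safe #-}
module Submission where

-- The Pak–Stanley labelling sends the region of x to f(j) = #{ i : x i + θ j i < x j },
-- where θ j i = 1 if j ≤ i and 0 otherwise; it is a bijection from the regions onto
-- the parking functions.  If x₁ < x₂ then the row of 1 is strictly contained in that
-- of 2, so f(1) < f(2); otherwise f(1) ≥ f(2), strictly if x₁ - x₂ > 1.  Hence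
-- R^{·<0} = lt = gt and eq ≤ R^{0<·<1}.  Exchanging x₁ and x₂ injects the regions with
-- 0 < x₁ - x₂ < 1, and those with x₁ - x₂ > 1, into the regions with x₁ < x₂.  So lt is
-- the largest part of both triples, and it occurs twice in the parking triple.
--
-- Injectivity: two configurations with equal labels are compared from the smallest
-- coordinate upwards, the labels determining at each step which point comes next and
-- its row.  Surjectivity: integer heights y whose weak and strict counts enclose f are
-- found by raising coordinates one at a time, and the ties are then broken one by one.
-- A region is a cell of sign patterns because cells are open and, by bisection of a
-- rational segment, connected.

open import Defs
open import Data.Bool.Base using (Bool; true; false; if_then_else_)
import Data.Bool.Properties as Bool
open import Data.Empty using (⊥)
open import Data.Fin.Base as Fin
  using (Fin; zero; suc; toℕ; fromℕ<; inject≤; punchIn; combine; finToFun; funToFin)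
import Data.Fin.Induction as Fin
open import Data.Fin.Patterns using (0F; 1F)
open import Data.Fin.Permutation as Perm
  using (Permutation′; _⟨$⟩ʳ_; _⟨$⟩ˡ_; _∘ₚ_; insert; insert-punchIn; inverseʳ; inverseˡ)
import Data.Fin.Properties as Fin
open import Data.Integer.Base as ℤ using (+_)
import Data.Integer.Properties as ℤ
open import Data.List.Membership.Propositional using () renaming (_∈_ to _∈ₗ_)
open import Data.List.Relation.Binary.Permutation.Propositional using (↭-sym)
open import Data.List.Relation.Binary.Permutation.Propositional.Properties using (∈-resp-↭)
open import Data.List.Relation.Unary.Any using (here; there)
open import Data.Nat.Base as ℕ using (ℕ; zero; suc; z≤n; s≤s)
import Data.Nat.ListAction as List
import Data.Nat.ListAction.Properties as List
import Data.Nat.Properties as ℕ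
open import Data.Product.Base using (Σ-syntax; ∃; ∃-syntax; _×_; _,_; proj₁; proj₂; map; map₂)
open import Data.Rational.Base as ℚ using (ℚ; mkℚ; 0ℚ; 1ℚ; ½; ∣_∣; toℚᵘ)
import Data.Rational.Properties as ℚ
open import Data.Rational.Solver using (module +-*-Solver)
open import Data.Rational.Unnormalised.Base as ℚᵘ using (mkℚᵘ; *≤*; *≡*)
import Data.Rational.Unnormalised.Properties as ℚᵘ
open import Data.Sum.Base using (_⊎_; inj₁; inj₂; [_,_]′)
open import Data.Vec.Functional using (updateAt)
open import Data.Vec.Functional.Properties using (updateAt-updates; updateAt-minimal)
open import Function.Base using (_∘_; id; const)
open import Function.Bundles using (Inverse)
import Function.Construct.Composition as Compose
open import Function.Definitions using (Injective)
open import Induction.WellFounded using (WellFounded; Acc; acc)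
open import Level using (Level; 0ℓ)
open import Relation.Binary.Bundles using (DecTotalOrder; Setoid; TotalOrder)
open import Relation.Binary.Core using (_Preserves_⟶_)
open import Relation.Binary.Definitions using (tri<; tri≈; tri>)
open import Relation.Binary.PropositionalEquality
  using (_≡_; _≢_; _≗_; refl; sym; trans; cong; cong₂; subst; subst₂; setoid; _→-setoid_;
         isEquivalence; module ≡-Reasoning)
open import Relation.Nullary using (Dec; yes; no; does; ¬_; ¬?; _×-dec_; _⊎-dec_; contradiction)
open import Relation.Nullary.Decidable using (decidable-stable; dec-true; dec-false; from-yes; map′)
open import Relation.Unary using (Pred; Decidable; _⊆_; _∪_; _∩_; _≐_)
open import Relation.Unary.Properties using (U?)

open ℝ

-- The order of the reals is not decidable, so nothing can be compared at an arbitrary point of a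
-- region. But every inhabited open set contains a rational point. A region is therefore represented
-- by a rational vector off all hyperplanes, and the combinatorics takes place on such vectors. Both
-- triples are counted on one finite set, the parking functions: the position of a region relative
-- to x₁ - x₂ = 0 and x₁ - x₂ = 1 becomes a decidable property of the rational point attached to its
-- label. The exchange is injective on each of the two classes with x₁ > x₂ separately: the image
-- determines every side except that of x₁ - x₂ = 1, and this side is constant on each class.
-- Together with eq ≤ R^{0<·<1} it also bounds eq by lt. That lt occurs twice in the parking triple
-- is what gives majorisation: the two largest parts there sum to at least 2 lt, which no two parts
-- of the other triple exceed.

private
  variable
    a b ℓ ℓ′ ℓp ℓq : Level
    m n k l : ℕ

-- Inverses and sizes of setoids.

module _ {S : Setoid a ℓ} {T : Setoid b ℓ′} where
  private
    module S = Setoid S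
    module T = Setoid T

  mkInverse : (to : S.Carrier → T.Carrier) (from : T.Carrier → S.Carrier) →
    (∀ {x y} → x S.≈ y → to x T.≈ to y) →
    (∀ {x y} → x T.≈ y → from x S.≈ from y) →
    (∀ y → to (from y) T.≈ y) → (∀ x → from (to x) S.≈ x) → Inverse S T
  mkInverse to from to-cong from-cong to∘from from∘to = record
    { to = to ; from = from ; to-cong = to-cong ; from-cong = from-cong
    ; inverse = (λ eq → T.trans (to-cong eq) (to∘from _))
              , (λ eq → S.trans (from-cong eq) (from∘to _)) }

module _ {S : Setoid a ℓ} {T : Setoid b ℓ′} where
  private
    module S = Setoid S
    module T = Setoid T

  restrict : {P : Pred S.Carrier ℓp} {Q : Pred T.Carrier ℓq} (i : Inverse S T) →
    (∀ x → P x → Q (Inverse.to i x)) → (∀ y → Q y → P (Inverse.from i y)) →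
    Inverse (S suchThat P) (T suchThat Q)
  restrict {P = P} {Q = Q} i P⇒Q Q⇒P = mkInverse {S = S suchThat P} {T = T suchThat Q}
    (λ (x , px) → i.to x , P⇒Q x px) (λ (y , qy) → i.from y , Q⇒P y qy)
    i.to-cong i.from-cong
    (λ (y , _) → i.inverseˡ S.refl) (λ (x , _) → i.inverseʳ T.refl)
    where module i = Inverse i

  size-≤ : HasSize S k → HasSize T l → (f : S.Carrier → T.Carrier) →
    (∀ {x y} → f x T.≈ f y → x S.≈ y) → k ℕ.≤ l
  size-≤ s t f injective = Fin.injective⇒≤ {f = t.from ∘ f ∘ s.to} λ eq →
    s-injective (injective (T.trans (T.sym (t.strictlyInverseˡ _))
      (T.trans (t.to-cong eq) (t.strictlyInverseˡ _))))
    where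
    module s = Inverse s
    module t = Inverse t
    s-injective : ∀ {x y} → s.to x S.≈ s.to y → x ≡ y
    s-injective eq = trans (sym (s.strictlyInverseʳ _))
      (trans (s.from-cong eq) (s.strictlyInverseʳ _))

-- Counting

count : {P : Pred (Fin n) ℓp} → Decidable P → ℕ
count {n = zero}  P? = 0
count {n = suc n} P? = (if does (P? zero) then 1 else 0) ℕ.+ count (P? ∘ suc)

element : {P : Pred (Fin n) ℓp} (P? : Decidable P) → Fin (count P?) → ∃ P
element {n = suc n} P? k with P? zero
element P? zero    | yes p = zero , p
element P? (suc k) | yes p = map suc id (element (P? ∘ suc) k)
element P? k       | no _  = map suc id (element (P? ∘ suc) k)

index : {P : Pred (Fin n) ℓp} (P? : Decidable P) → ∀ i → P i → Fin (count P?)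
index {n = suc n} P? i pi with P? zero
index P? zero    pi | yes _ = zero
index P? (suc i) pi | yes _ = suc (index (P? ∘ suc) i pi)
index P? zero    pi | no ¬p = contradiction pi ¬p
index P? (suc i) pi | no _  = index (P? ∘ suc) i pi

index-cong : {P : Pred (Fin n) ℓp} (P? : Decidable P) → ∀ {i j} pi pj → i ≡ j →
  index P? i pi ≡ index P? j pj
index-cong {n = suc n} P? pi pj eq with P? zero
index-cong P? {zero}  pi pj refl | yes _ = refl
index-cong P? {suc _} pi pj refl | yes _ = cong suc (index-cong (P? ∘ suc) pi pj refl)
index-cong P? {zero}  pi pj refl | no ¬p = contradiction pi ¬p
index-cong P? {suc _} pi pj refl | no _  = index-cong (P? ∘ suc) pi pj refl

element∘index : {P : Pred (Fin n) ℓp} (P? : Decidable P) → ∀ i pi →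
  proj₁ (element P? (index P? i pi)) ≡ i
element∘index {n = suc n} P? i pi with P? zero
element∘index P? zero    pi | yes _ = refl
element∘index P? (suc i) pi | yes _ = cong suc (element∘index (P? ∘ suc) i pi)
element∘index P? zero    pi | no ¬p = contradiction pi ¬p
element∘index P? (suc i) pi | no _  = cong suc (element∘index (P? ∘ suc) i pi)

index∘element : {P : Pred (Fin n) ℓp} (P? : Decidable P) → ∀ k →
  index P? (proj₁ (element P? k)) (proj₂ (element P? k)) ≡ k
index∘element {n = suc n} P? k with P? zero
index∘element P? zero    | yes _ = refl
index∘element P? (suc k) | yes _ = cong suc (index∘element (P? ∘ suc) k)
index∘element P? k       | no _  = index∘element (P? ∘ suc) k

count-size : {P : Pred (Fin n) ℓp} (P? : Decidable P) →
  HasSize (setoid (Fin n) suchThat P) (count P?)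
count-size {n = n} {P = P} P? = mkInverse {T = setoid (Fin n) suchThat P} (element P?) (λ (i , pi) → index P? i pi)
  (λ eq → cong (proj₁ ∘ element P?) eq) (λ {x} {y} → index-cong P? (proj₂ x) (proj₂ y))
  (λ (i , pi) → element∘index P? i pi) (index∘element P?)

element-injective : {P : Pred (Fin n) ℓp} (P? : Decidable P) →
  Injective _≡_ _≡_ (proj₁ ∘ element P?)
element-injective P? {k} {l} eq = trans (sym (index∘element P? k))
  (trans (index-cong P? _ _ eq) (index∘element P? l))

module _ {P : Pred (Fin n) ℓp} (P? : Decidable P) where

  injection⇒≤count : {h : Fin k → Fin n} → Injective _≡_ _≡_ h → (∀ i → P (h i)) →
    k ℕ.≤ count P?
  injection⇒≤count {h = h} inj ph = Fin.injective⇒≤ {f = λ i → index P? (h i) (ph i)}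
    λ {i} {j} eq → inj (trans (sym (element∘index P? (h i) (ph i)))
      (trans (cong (proj₁ ∘ element P?) eq) (element∘index P? (h j) (ph j))))

  count≤n : count P? ℕ.≤ n
  count≤n = Fin.injective⇒≤ (element-injective P?)

  count≤ : (g : Fin n → ℕ) → (∀ {i j} → P i → P j → g i ≡ g j → i ≡ j) →
    (∀ {i} → P i → g i ℕ.< k) → count P? ℕ.≤ k
  count≤ g inj bound = Fin.injective⇒≤ {f = λ i → fromℕ< (bound (proj₂ (element P? i)))}
    λ {i} {j} eq → element-injective P? (inj (proj₂ (element P? i)) (proj₂ (element P? j))
      (Fin.fromℕ<-injective _ _ _ _ eq))

module _ {P : Pred (Fin n) ℓp} {Q : Pred (Fin n) ℓq} (P? : Decidable P) (Q? : Decidable Q) where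

  count-mono : P ⊆ Q → count P? ℕ.≤ count Q?
  count-mono P⊆Q = injection⇒≤count Q? (element-injective P?) (λ k → P⊆Q (proj₂ (element P? k)))

  count-strict : P ⊆ Q → ∀ {i} → Q i → ¬ P i → count P? ℕ.< count Q?
  count-strict P⊆Q {i} qi ¬pi = injection⇒≤count Q? {h = h} inj
    λ { zero → qi ; (suc k) → P⊆Q (proj₂ (element P? k)) }
    where
    h : Fin (suc (count P?)) → Fin n
    h zero    = i
    h (suc k) = proj₁ (element P? k)
    inj : Injective _≡_ _≡_ h
    inj {zero}  {zero}  eq = refl
    inj {zero}  {suc l} eq = contradiction (subst P (sym eq) (proj₂ (element P? l))) ¬pi
    inj {suc k} {zero}  eq = contradiction (subst P eq (proj₂ (element P? k))) ¬pi
    inj {suc k} {suc l} eq = cong suc (element-injective P? eq)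

  count-witness : count P? ℕ.< count Q? → ∃[ i ] (Q i × ¬ P i)
  count-witness lt with Fin.any? (λ i → Q? i ×-dec ¬? (P? i))
  ... | yes w = w
  ... | no ¬w = contradiction lt (ℕ.≤⇒≯ (injection⇒≤count P? (element-injective Q?)
    λ k → decidable-stable (P? _) λ ¬p → ¬w (_ , proj₂ (element Q? k) , ¬p)))

count-cong : {P : Pred (Fin n) ℓp} {Q : Pred (Fin n) ℓq} (P? : Decidable P) (Q? : Decidable Q) →
  P ⊆ Q → Q ⊆ P → count P? ≡ count Q?
count-cong P? Q? P⊆Q Q⊆P = ℕ.≤-antisym (count-mono P? Q? P⊆Q) (count-mono Q? P? Q⊆P)

count-U : count {n = n} U? ≡ n
count-U = ℕ.≤-antisym (count≤n U?) (injection⇒≤count U? {h = id} id _)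

count<n⇒∃¬ : {P : Pred (Fin n) ℓp} (P? : Decidable P) → count P? ℕ.< n → ∃[ i ] ¬ P i
count<n⇒∃¬ P? lt = map id proj₂ (count-witness P? U? (ℕ.<-≤-trans lt (ℕ.≤-reflexive (sym count-U))))

∃¬⇒count<n : {P : Pred (Fin n) ℓp} (P? : Decidable P) → ∃[ i ] ¬ P i → count P? ℕ.< n
∃¬⇒count<n P? (i , ¬pi) = ℕ.<-≤-trans (count-strict P? U? _ {i} _ ¬pi) (count≤n U?)

count-disjoint : {A : Pred (Fin n) a} {B : Pred (Fin n) b} {C : Pred (Fin n) ℓp}
  (A? : Decidable A) (B? : Decidable B) (C? : Decidable C) →
  (∀ i → A i → ¬ B i) → A ⊆ C → B ⊆ C → C ⊆ A ∪ B →
  count A? ℕ.+ count B? ≡ count C?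
count-disjoint {n = zero}  A? B? C? dis A⊆C B⊆C C⊆A∪B = refl
count-disjoint {n = suc n} A? B? C? dis A⊆C B⊆C C⊆A∪B
  with A? zero | B? zero | C? zero
     | count-disjoint (A? ∘ suc) (B? ∘ suc) (C? ∘ suc) (dis ∘ suc) A⊆C B⊆C C⊆A∪B
... | yes x | yes y | _     | ih = contradiction y (dis zero x)
... | yes x | no _  | yes _ | ih = cong suc ih
... | yes x | no _  | no ¬z | ih = contradiction (A⊆C x) ¬z
... | no _  | yes y | yes _ | ih = trans (ℕ.+-suc _ _) (cong suc ih)
... | no _  | yes y | no ¬z | ih = contradiction (B⊆C y) ¬z
... | no ¬x | no ¬y | yes z | ih = [ (λ x → contradiction x ¬x) , (λ y → contradiction y ¬y) ]′ (C⊆A∪B z)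
... | no _  | no _  | no _  | ih = ih

count-trichotomy : {A : Pred (Fin n) a} {B : Pred (Fin n) b} {C : Pred (Fin n) ℓp} {P : Pred (Fin n) ℓq}
  (A? : Decidable A) (B? : Decidable B) (C? : Decidable C) (P? : Decidable P) →
  (∀ i → A i → ¬ B i) → (∀ i → A i → ¬ C i) → (∀ i → B i → ¬ C i) →
  A ∪ B ∪ C ⊆ P → P ⊆ A ∪ B ∪ C →
  count A? ℕ.+ count B? ℕ.+ count C? ≡ count P?
count-trichotomy A? B? C? P? ¬AB ¬AC ¬BC ⊆P P⊆ = trans
  (cong (ℕ._+ count C?) (count-disjoint A? B? A∪B? ¬AB inj₁ inj₂ id))
  (count-disjoint A∪B? C? P? (λ i → [ ¬AC i , ¬BC i ]′)
    [ ⊆P ∘ inj₁ , ⊆P ∘ inj₂ ∘ inj₁ ]′ (⊆P ∘ inj₂ ∘ inj₂)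
    ([ inj₁ ∘ inj₁ , [ inj₁ ∘ inj₂ , inj₂ ]′ ]′ ∘ P⊆))
  where
  A∪B? : Decidable (λ i → _)
  A∪B? i = A? i ⊎-dec B? i

-- Least elements and sorting in a total order.

module _ {c ℓ₁ ℓ₂} (O : TotalOrder c ℓ₁ ℓ₂) where
  private module O = TotalOrder O

  argmin : (g : Fin n → O.Carrier) {P : Pred (Fin n) ℓp} → Decidable P → ∃ P →
    ∃[ i ] (P i × (∀ j → P j → g i O.≤ g j))
  argmin {n = suc n} g P? ∃P with P? zero | Fin.any? (P? ∘ suc)
  ... | yes p0 | no ¬P = zero , p0 , λ { zero _ → O.refl ; (suc j) pj → contradiction (j , pj) ¬P }
  ... | no ¬p0 | no ¬P with ∃P
  ...   | zero  , p0 = contradiction p0 ¬p0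
  ...   | suc j , pj = contradiction (j , pj) ¬P
  argmin {n = suc n} g P? _ | P0? | yes ∃P′ with argmin (g ∘ suc) (P? ∘ suc) ∃P′ | P0?
  ... | i , pi , min | no ¬p0 = suc i , pi , λ { zero p0 → contradiction p0 ¬p0 ; (suc j) → min j }
  ... | i , pi , min | yes p0 with O.total (g zero) (g (suc i))
  ...   | inj₁ le = zero , p0 , λ { zero _ → O.refl ; (suc j) pj → O.trans le (min j pj) }
  ...   | inj₂ ge = suc i , pi , λ { zero _ → ge ; (suc j) → min j }

  sort : (g : Fin n → O.Carrier) → Σ[ π ∈ Permutation′ n ] ((g ∘ (π ⟨$⟩ʳ_)) Preserves Fin._≤_ ⟶ O._≤_)
  sort {n = zero}  g = Perm.id , λ { {()} }
  sort {n = suc n} g with argmin g U? (zero , _)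
  ... | i , _ , min with sort (g ∘ punchIn i)
  ...   | π , mono = insert zero i π , sorted
    where
    later : ∀ k → insert zero i π ⟨$⟩ʳ suc k ≡ punchIn i (π ⟨$⟩ʳ k)
    later = insert-punchIn zero i π
    sorted : (g ∘ (insert zero i π ⟨$⟩ʳ_)) Preserves Fin._≤_ ⟶ O._≤_
    sorted {zero}  {l}     _         = min (insert zero i π ⟨$⟩ʳ l) _
    sorted {suc k} {suc l} (s≤s k≤l) rewrite later k | later l = mono k≤l

-- Hall's condition for parking functions

-- This is the condition for a G-parking function on the complete graph whose vertices are the n
-- positions and a sink: `f j` is less than the number of edges from j that leave H, the edge to the
-- sink included.
Hall : (Fin n → ℕ) → Set₁
Hall {n} f = {H : Pred (Fin n) 0ℓ} (H? : Decidable H) → ∃ H →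
  ∃[ j ] (H j × f j ℕ.≤ count (¬? ∘ H?))

-- The form that a finite check decides; `IsParking` and `Hall` quantify over permutations and
-- predicates.
Below : (Fin n → Fin n) → Set
Below {n} f = (k : Fin n) → toℕ k ℕ.< count (λ j → f j Fin.≤? k)

π-injective : (π : Permutation′ n) → ∀ {i j} → π ⟨$⟩ʳ i ≡ π ⟨$⟩ʳ j → i ≡ j
π-injective π {i} {j} eq = trans (sym (inverseˡ π)) (trans (cong (π ⟨$⟩ˡ_) eq) (inverseˡ π))

-- Pigeonhole: with c positions outside H, the first c + 1 positions in sorted order have values at
-- most c, and they cannot all lie outside H.
parking⇒hall : {f : Fin n → Fin n} → IsParking f → Hall (toℕ ∘ f)
parking⇒hall {n} {f} (π , _ , bound) {H} H? (h , Hh) =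
  decidable-stable (Fin.any? λ j → H? j ×-dec (toℕ (f j) ℕ.≤? c)) λ none →
    ℕ.<-irrefl refl (injection⇒≤count (¬? ∘ H?) {h = position}
      (λ eq → Fin.inject≤-injective _ _ _ _ (π-injective π eq))
      λ i Hi → none (position i , Hi , ℕ.s≤s⁻¹ (ℕ.≤-trans (bound (inject≤ i c<n))
        (ℕ.≤-trans (ℕ.≤-reflexive (cong suc (Fin.toℕ-inject≤ i c<n))) (Fin.toℕ<n i)))))
  where
  c = count (¬? ∘ H?)
  c<n : c ℕ.< n
  c<n = ∃¬⇒count<n (¬? ∘ H?) (h , λ ¬Hh → ¬Hh Hh)
  position : Fin (suc c) → Fin n
  position i = π ⟨$⟩ʳ inject≤ i c<n

-- Hall's condition is applied to the set of j with `f j` greater than k. If at most k positions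
-- were low, it would yield a member of that set with value at most k.
hall⇒below : {f : Fin n → Fin n} → Hall (toℕ ∘ f) → Below f
hall⇒below {n} {f} hall k = decidable-stable (_ ℕ.<? _) λ ≮ →
  let h , ¬low = count<n⇒∃¬ low? (ℕ.≤-<-trans (ℕ.≮⇒≥ ≮) (Fin.toℕ<n k))
      j , high , fj≤ = hall (¬? ∘ low?) (h , ¬low)
  in high (ℕ.≤-trans fj≤ (ℕ.≤-trans
       (count-mono _ low? λ ¬¬low → decidable-stable (low? _) ¬¬low) (ℕ.≮⇒≥ ≮)))
  where
  low? : Decidable (λ j → f j Fin.≤ k)
  low? j = f j Fin.≤? k

-- If the sorted value at i exceeded i, all values at most i would sit at sorted positions before i,
-- so there would be at most i of them.
below⇒parking : {f : Fin n → Fin n} → Below f → IsParking f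
below⇒parking {n} {f} below with sort (Fin.≤-totalOrder n) f
... | π , mono = π , mono , λ i → decidable-stable (_ ℕ.<? _) λ ≮ →
  ℕ.<⇒≱ (below i) (count≤ _ (toℕ ∘ (π ⟨$⟩ˡ_))
    (λ _ _ eq → trans (sym (inverseʳ π)) (trans (cong (π ⟨$⟩ʳ_) (Fin.toℕ-injective eq)) (inverseʳ π)))
    λ {j} fj≤i → ℕ.≰⇒> λ i≤ → ≮ (s≤s (ℕ.≤-trans (mono i≤)
      (ℕ.≤-trans (ℕ.≤-reflexive (cong (toℕ ∘ f) (inverseʳ π))) fj≤i))))

isParking? : (f : Fin n → Fin n) → Dec (IsParking f)
isParking? f = map′ below⇒parking (hall⇒below ∘ parking⇒hall)
  (Fin.all? λ k → toℕ k ℕ.<? count (λ j → f j Fin.≤? k))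

isParking-resp : {f g : Fin n → Fin n} → f ≗ g → IsParking f → IsParking g
isParking-resp f≗g (π , mono , bound) = π
  , (λ {i} {j} i≤j → subst (Fin._≤ _) (f≗g _) (subst (_ Fin.≤_) (f≗g _) (mono i≤j)))
  , λ i → subst (λ x → toℕ x ℕ.< suc (toℕ i)) (f≗g _) (bound i)

-- Functions between finite sets, coded by numbers.

funToFin-cong : {f g : Fin m → Fin n} → f ≗ g → funToFin f ≡ funToFin g
funToFin-cong {zero}  f≗g = refl
funToFin-cong {suc m} f≗g = cong₂ combine (f≗g zero) (funToFin-cong (f≗g ∘ suc))

module _ {P : Pred (Fin m → Fin n) ℓp} (P-resp : ∀ {f g} → f ≗ g → P f → P g) where

  codes : Inverse (setoid (Fin (n ℕ.^ m)) suchThat (P ∘ finToFun)) ((Fin m →-setoid Fin n) suchThat P)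
  codes = mkInverse {T = (Fin m →-setoid Fin n) suchThat P} (λ (c , pc) → finToFun c , pc)
    (λ (f , pf) → funToFin f , P-resp (sym ∘ Fin.finToFun-funToFin f) pf)
    (λ { refl _ → refl }) funToFin-cong
    (λ (f , _) → Fin.finToFun-funToFin f) (λ (c , _) → Fin.funToFin-finToFin {m} {n} c)

  functions-size : (P? : Decidable P) → HasSize ((Fin m →-setoid Fin n) suchThat P) (count (P? ∘ finToFun))
  functions-size P? = Compose.inverse (count-size (P? ∘ finToFun)) codes

-- Pak–Stanley labels and their injectivity

θ : Fin n → Fin n → ℕ
θ j i = if does (j Fin.≤? i) then 1 else 0

θ≡1 : {j i : Fin n} → j Fin.≤ i → θ j i ≡ 1
θ≡1 {j = j} {i} j≤i rewrite dec-true (j Fin.≤? i) j≤i = refl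

θ≡0 : {j i : Fin n} → i Fin.< j → θ j i ≡ 0
θ≡0 {j = j} {i} i<j rewrite dec-false (j Fin.≤? i) (ℕ.<⇒≱ i<j) = refl

θ-antitone : {j j′ : Fin n} (i : Fin n) → j Fin.≤ j′ → θ j′ i ℕ.≤ θ j i
θ-antitone {j = j} {j′} i j≤j′ with ℕ.<-≤-connex (toℕ i) (toℕ j′)
... | inj₁ i<j′ = ℕ.≤-trans (ℕ.≤-reflexive (θ≡0 i<j′)) z≤n
... | inj₂ j′≤i = ℕ.≤-reflexive (trans (θ≡1 j′≤i) (sym (θ≡1 (ℕ.≤-trans j≤j′ j′≤i))))

θ≤1 : (j i : Fin n) → θ j i ℕ.≤ 1
θ≤1 j i with ℕ.<-≤-connex (toℕ i) (toℕ j)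
... | inj₁ i<j = ℕ.≤-trans (ℕ.≤-reflexive (θ≡0 i<j)) z≤n
... | inj₂ j≤i = ℕ.≤-reflexive (θ≡1 j≤i)

ι : ℕ → ℚ
ι zero    = 0ℚ
ι (suc k) = 1ℚ ℚ.+ ι k

ι-nonNeg : ∀ k → 0ℚ ℚ.≤ ι k
ι-nonNeg zero    = ℚ.≤-refl
ι-nonNeg (suc k) = ℚ.+-mono-≤ (from-yes (0ℚ ℚ.≤? 1ℚ)) (ι-nonNeg k)

ι-mono : ∀ {k l} → k ℕ.≤ l → ι k ℚ.≤ ι l
ι-mono {l = l} z≤n = ι-nonNeg l
ι-mono (s≤s k≤l)   = ℚ.+-monoʳ-≤ 1ℚ (ι-mono k≤l)

-- The Shi hyperplanes are exactly the x j - x i = θ j i with j ≢ i, each arising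
-- once, so a region is the same as the relation x ⊢ j ▷ i.  The pair (i , i)
-- imposes nothing, since θ i i = 1.
infix 4 _⊢_▷_

_⊢_▷_ : (Fin n → ℚ) → Fin n → Fin n → Set
x ⊢ j ▷ i = x i ℚ.+ ι (θ j i) ℚ.< x j

_⊢_▷?_ : (x : Fin n → ℚ) (j i : Fin n) → Dec (x ⊢ j ▷ i)
x ⊢ j ▷? i = _ ℚ.<? _

private
  ℚ-order = DecTotalOrder.totalOrder ℚ.≤-decTotalOrder

<⇒≱ : ∀ {r s : ℚ} → r ℚ.< s → ¬ (s ℚ.≤ r)
<⇒≱ r<s s≤r = ℚ.<-irrefl refl (ℚ.<-≤-trans r<s s≤r)

Generic : (Fin n → ℚ) → Set
Generic x = ∀ j i → x j ≢ x i ℚ.+ ι (θ j i)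

-- The Pak–Stanley label of the region of x.
label : (Fin n → ℚ) → Fin n → ℕ
label x j = count (x ⊢ j ▷?_)

module _ (x : Fin n → ℚ) where

  ▷-mono : ∀ {i j i′ j′} → x i ℚ.≤ x i′ → θ j i ℕ.≤ θ j′ i′ → x j′ ℚ.≤ x j →
    x ⊢ j′ ▷ i′ → x ⊢ j ▷ i
  ▷-mono xi≤ θ≤ xj≥ lt =
    ℚ.≤-<-trans (ℚ.+-mono-≤ xi≤ (ι-mono θ≤)) (ℚ.<-≤-trans lt xj≥)

  ▷⇒< : ∀ {j i} → x ⊢ j ▷ i → x i ℚ.< x j
  ▷⇒< {j} {i} = ℚ.≤-<-trans (ℚ.≤-trans (ℚ.≤-reflexive (sym (ℚ.+-identityʳ (x i))))
    (ℚ.+-monoʳ-≤ (x i) (ι-mono {0} {θ j i} z≤n)))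

  <⇒▷ : ∀ {j i} → i Fin.< j → x i ℚ.< x j → x ⊢ j ▷ i
  <⇒▷ {j} {i} i<j rewrite θ≡0 i<j | ℚ.+-identityʳ (x i) = id

  -- The row of j contains only points strictly below j, so the row of the lowest member of H avoids
  -- H.
  label-hall : Hall (label x)
  label-hall H? ∃H with argmin ℚ-order x H? ∃H
  ... | j , Hj , min = j , Hj , count-mono (x ⊢ j ▷?_) (¬? ∘ H?)
    λ {i} j▷i Hi → <⇒≱ (▷⇒< j▷i) (min i Hi)

  module _ (generic : Generic x) where

    generic-injective : ∀ {i j} → x i ≡ x j → i ≡ j
    generic-injective {i} {j} eq with Fin.<-cmp i j
    ... | tri≈ _ i≡j _ = i≡j
    ... | tri< i<j _ _ = contradiction
      (trans (sym eq) (trans (sym (ℚ.+-identityʳ (x i))) (cong (λ k → x i ℚ.+ ι k) (sym (θ≡0 i<j)))))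
      (generic j i)
    ... | tri> _ _ j<i = contradiction
      (trans eq (trans (sym (ℚ.+-identityʳ (x j))) (cong (λ k → x j ℚ.+ ι k) (sym (θ≡0 j<i)))))
      (generic i j)

    ≤∧≢⇒< : ∀ {i j} → i ≢ j → x i ℚ.≤ x j → x i ℚ.< x j
    ≤∧≢⇒< i≢j le = ℚ.≰⇒> λ ge → i≢j (generic-injective (ℚ.≤-antisym le ge))

-- Let b come first after E.  Its row consists of the i < b in E and of an initial
-- segment of the i > b in E, so it is determined by its size and the order on E.
module _ {x y : Fin n → ℚ} (x-generic : Generic x) (y-generic : Generic y) (same : label x ≗ label y)
  {E : Pred (Fin n) 0ℓ} (E? : Decidable E)
  (x-initial : ∀ {i j} → E i → ¬ E j → x i ℚ.< x j)
  (y-initial : ∀ {i j} → E i → ¬ E j → y i ℚ.< y j)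
  (agree : ∀ {i j} → E i → E j → y i ℚ.< y j → x i ℚ.< x j)
  {b} (¬Eb : ¬ E b) (b-min : ∀ j → ¬ E j → y b ℚ.≤ y j)
  where

  private
    below-min : ∀ {z : Fin n → ℚ} {c i} → (∀ j → ¬ E j → z c ℚ.≤ z j) → z ⊢ c ▷ i → E i
    below-min {z} min c▷i = decidable-stable (E? _) λ ¬Ei → <⇒≱ (▷⇒< z c▷i) (min _ ¬Ei)

  -- Suppose e is missing from the row of b in y. The i < b in E belong to both rows, and every i ≥
  -- b in the y-row lies below e in y, hence in x. So the y-row would be a proper part of the x-row,
  -- against equal labels.
  row-min : ∀ {e} → E e → x ⊢ b ▷ e → y ⊢ b ▷ e
  row-min {e} Ee b▷e = decidable-stable (y ⊢ b ▷? e) λ ¬b▷e →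
    let b≤e = ℕ.≮⇒≥ λ e<b → ¬b▷e (<⇒▷ y e<b (y-initial Ee ¬Eb)) in
    ℕ.<-irrefl (sym (same b)) (count-strict (y ⊢ b ▷?_) (x ⊢ b ▷?_)
      (λ {i} b▷i → let Ei = below-min b-min b▷i in
        [ (λ i<b → <⇒▷ x i<b (x-initial Ei ¬Eb))
        , (λ b≤i → ▷-mono x
            (ℚ.<⇒≤ (agree Ei Ee (ℚ.≰⇒> λ ye≤yi → ¬b▷e
              (▷-mono y ye≤yi (ℕ.≤-reflexive (trans (θ≡1 b≤e) (sym (θ≡1 b≤i)))) ℚ.≤-refl b▷i))))
            (ℕ.≤-reflexive (trans (θ≡1 b≤i) (sym (θ≡1 b≤e)))) ℚ.≤-refl b▷e)
        ]′ (ℕ.<-≤-connex (toℕ i) (toℕ b)))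
      {e} b▷e ¬b▷e)

  module _ {a} (¬Ea : ¬ E a) (a-min : ∀ j → ¬ E j → x a ℚ.≤ x j) where

    -- In y the row of a contains b, which is outside E, so its part within E is smaller than the
    -- x-row of a. Some e in the x-row is thus lost in y. Since b < a ≤ e, the threshold is 1 for
    -- both a and b, and `row-min` carries e from a to b in x, then from x to y, then back to a.
    mins-≮ : ¬ b Fin.< a
    mins-≮ b<a =
      let e , a▷e , ¬both = count-witness (λ i → (y ⊢ a ▷? i) ×-dec E? i) (x ⊢ a ▷?_)
            (ℕ.<-≤-trans (count-strict _ (y ⊢ a ▷?_) proj₁
              (<⇒▷ y b<a (≤∧≢⇒< y y-generic (Fin.<⇒≢ b<a) (b-min a ¬Ea))) (¬Eb ∘ proj₂))
              (ℕ.≤-reflexive (sym (same a))))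
          Ee = below-min a-min a▷e
          ¬a▷e = λ a▷e → ¬both (a▷e , Ee)
          a≤e = ℕ.≮⇒≥ λ e<a → ¬a▷e (<⇒▷ y e<a (y-initial Ee ¬Ea))
          b≤e = ℕ.≤-trans (ℕ.<⇒≤ b<a) a≤e
      in ¬a▷e (▷-mono y ℚ.≤-refl (θ-antitone e (ℕ.<⇒≤ b<a)) (b-min a ¬Ea)
           (row-min Ee (▷-mono x ℚ.≤-refl
             (ℕ.≤-reflexive (trans (θ≡1 b≤e) (sym (θ≡1 a≤e)))) (a-min b ¬Eb) a▷e)))

module _ {x y : Fin n → ℚ} (x-generic : Generic x) (y-generic : Generic y) (same : label x ≗ label y) where

  private
    Agree : Fin n → Set
    Agree a = (∀ i → x i ℚ.< x a → y i ℚ.< y a) × (∀ i → y i ℚ.< y a → x i ℚ.< x a)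
            × (∀ i → x ⊢ a ▷ i → y ⊢ a ▷ i)

    -- The points before a in x form, by induction, an initial segment of y as well. The next point
    -- b of y must be a: `mins-≮` excludes b < a, and with x and y interchanged it excludes a < b.
    agree-step : ∀ a → (∀ {i} → x i ℚ.< x a → Agree i) → Agree a
    agree-step a ih = go (argmin ℚ-order y (¬? ∘ E?) (a , ¬Ea))
      where
      E : Pred (Fin n) 0ℓ
      E i = x i ℚ.< x a
      E? : Decidable E
      E? i = x i ℚ.<? x a
      ¬Ea : ¬ E a
      ¬Ea = ℚ.<-irrefl refl
      x-initial : ∀ {i j} → E i → ¬ E j → x i ℚ.< x j
      x-initial Ei ¬Ej = ℚ.<-≤-trans Ei (ℚ.≮⇒≥ ¬Ej)
      y-initial : ∀ {i j} → E i → ¬ E j → y i ℚ.< y j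
      y-initial {i} {j} Ei ¬Ej = ≤∧≢⇒< y y-generic (λ { refl → ¬Ej Ei })
        (ℚ.≮⇒≥ λ yj<yi → ¬Ej (ℚ.<-trans (proj₁ (proj₂ (ih Ei)) j yj<yi) Ei))
      y⇒x : ∀ {i j} → E i → E j → y i ℚ.< y j → x i ℚ.< x j
      y⇒x Ei Ej = proj₁ (proj₂ (ih Ej)) _
      x⇒y : ∀ {i j} → E i → E j → x i ℚ.< x j → y i ℚ.< y j
      x⇒y Ei Ej = proj₁ (ih Ej) _
      a-min : ∀ j → ¬ E j → x a ℚ.≤ x j
      a-min j = ℚ.≮⇒≥
      go : ∃[ b ] (¬ E b × (∀ j → ¬ E j → y b ℚ.≤ y j)) → Agree a
      go (b , ¬Eb , b-min) with Fin.<-cmp b a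
      ... | tri< b<a _ _ = contradiction b<a
        (mins-≮ x-generic y-generic same E? x-initial y-initial y⇒x ¬Eb b-min ¬Ea a-min)
      ... | tri> _ _ a<b = contradiction a<b
        (mins-≮ y-generic x-generic (sym ∘ same) E? y-initial x-initial x⇒y ¬Ea a-min ¬Eb b-min)
      ... | tri≈ _ refl _ = (λ i Ei → y-initial Ei ¬Ea)
        , (λ i yi<ya → decidable-stable (E? i) λ ¬Ei → <⇒≱ yi<ya (b-min i ¬Ei))
        , λ i a▷i → row-min x-generic y-generic same E? x-initial y-initial y⇒x ¬Eb b-min
            (▷⇒< x a▷i) a▷i

    x-wellFounded : WellFounded (λ i j → x i ℚ.< x j)
    x-wellFounded = Fin.spo-wellFounded record
      { isEquivalence = isEquivalence
      ; irrefl = λ { refl → ℚ.<-irrefl refl }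
      ; trans = ℚ.<-trans
      ; <-resp-≈ = (λ { refl lt → lt }) , (λ { refl lt → lt }) }

    agree-all : ∀ a → Agree a
    agree-all a = go a (x-wellFounded a)
      where
      go : ∀ a → Acc (λ i j → x i ℚ.< x j) a → Agree a
      go a (acc rs) = agree-step a λ lt → go _ (rs lt)

  label-injective : ∀ j i → x ⊢ j ▷ i → y ⊢ j ▷ i
  label-injective j = proj₂ (proj₂ (agree-all j))

-- Surjectivity

sum : (Fin n → ℕ) → ℕ
sum {zero}  g = 0
sum {suc n} g = g zero ℕ.+ sum (g ∘ suc)

sum-suc : (g : Fin n → ℕ) (j : Fin n) → sum (updateAt g j suc) ≡ suc (sum g)
sum-suc g zero    = refl
sum-suc g (suc j) = trans (cong (g zero ℕ.+_) (sum-suc (g ∘ suc) j)) (ℕ.+-suc _ _)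

sum≤ : ∀ {b} (g : Fin n → ℕ) → (∀ i → g i ℕ.≤ b) → sum g ℕ.≤ n ℕ.* b
sum≤ {zero}  g g≤b = z≤n
sum≤ {suc n} g g≤b = ℕ.+-mono-≤ (g≤b zero) (sum≤ (g ∘ suc) (g≤b ∘ suc))

≤sum : (g : Fin n → ℕ) (i : Fin n) → g i ℕ.≤ sum g
≤sum g zero    = ℕ.m≤m+n _ _
≤sum g (suc i) = ℕ.≤-trans (≤sum (g ∘ suc) i) (ℕ.m≤n+m _ (g zero))

module _ {N a b d e : ℕ} where

  lex-< : a ℕ.< b → d ℕ.< N → a ℕ.* N ℕ.+ d ℕ.< b ℕ.* N ℕ.+ e
  lex-< a<b d<N = begin-strict
    a ℕ.* N ℕ.+ d <⟨ ℕ.+-monoʳ-< (a ℕ.* N) d<N ⟩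
    a ℕ.* N ℕ.+ N ≡⟨ ℕ.+-comm (a ℕ.* N) N ⟩
    suc a ℕ.* N ≤⟨ ℕ.*-monoˡ-≤ N a<b ⟩
    b ℕ.* N     ≤⟨ ℕ.m≤m+n _ _ ⟩
    b ℕ.* N ℕ.+ e ∎
    where open ℕ.≤-Reasoning

lex-cancel : ∀ {N a b d e} → d ℕ.< N → e ℕ.< N → a ℕ.* N ℕ.+ d ℕ.< b ℕ.* N ℕ.+ e → a ℕ.< b ⊎ (a ≡ b × d ℕ.< e)
lex-cancel {N} {a} {b} {d} {e} d<N e<N lt with ℕ.<-cmp a b
... | tri< a<b _ _  = inj₁ a<b
... | tri≈ _ refl _ = inj₂ (refl , ℕ.+-cancelˡ-< (a ℕ.* N) d e lt)
... | tri> _ _ b<a  = contradiction lt (ℕ.<-asym (lex-< b<a e<N))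

lex-≡ : ∀ {N a b d e} → d ℕ.< N → e ℕ.< N → a ℕ.* N ℕ.+ d ≡ b ℕ.* N ℕ.+ e → a ≡ b × d ≡ e
lex-≡ {N} {a} {b} {d} {e} d<N e<N eq with ℕ.<-cmp a b
... | tri< a<b _ _  = contradiction eq (ℕ.<⇒≢ (lex-< a<b d<N))
... | tri≈ _ refl _ = refl , ℕ.+-cancelˡ-≡ (a ℕ.* N) d e eq
... | tri> _ _ b<a  = contradiction (sym eq) (ℕ.<⇒≢ (lex-< b<a e<N))

module _ (y : Fin n → ℕ) (j : Fin n) where

  -- Integer heights lie on hyperplanes, and each tight pair is a tie still to be broken. Breaking
  -- ties leaves the row of j between its low and its high set.
  low? : Decidable (λ i → y i ℕ.+ θ j i ℕ.< y j)
  low? i = _ ℕ.<? _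

  high? : Decidable (λ i → y i ℕ.+ θ j i ℕ.≤ y j)
  high? i = _ ℕ.≤? _

  tight? : Decidable (λ i → y i ℕ.+ θ j i ≡ y j)
  tight? i = _ ℕ.≟ _

  before? : (δ : Fin n → ℕ) → Decidable (λ i → y i ℕ.+ θ j i ≡ y j × δ i ℕ.< δ j)
  before? δ i = tight? i ×-dec (δ i ℕ.<? δ j)

module _ (f : Fin n → ℕ) (hall : Hall f) where

  Balanced : (Fin n → ℕ) → Set
  Balanced y = ∀ j → count (low? y j) ℕ.≤ f j × f j ℕ.≤ count (high? y j)

  private
    -- The invariant of the raising process. It keeps the low sets small enough and, through Hall's
    -- condition, keeps the heights bounded.
    Minimal : (Fin n → ℕ) → Set
    Minimal y = ∀ j → y j ≡ 0 ⊎ count (low? y j) ℕ.< f j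

    ≤-raise : ∀ y (j l : Fin n) → y l ℕ.≤ updateAt y j suc l
    ≤-raise y j l with l Fin.≟ j
    ... | yes refl = ℕ.≤-trans (ℕ.n≤1+n _) (ℕ.≤-reflexive (sym (updateAt-updates j y)))
    ... | no l≢j   = ℕ.≤-reflexive (sym (updateAt-minimal l j y l≢j))

    -- After the raise the low set of j is contained in its former high set, while the low sets of
    -- all other coordinates can only shrink.
    raise-minimal : ∀ {y} j → Minimal y → count (high? y j) ℕ.< f j → Minimal (updateAt y j suc)
    raise-minimal {y} j minimal high<f i with i Fin.≟ j
    ... | yes refl = inj₂ (ℕ.≤-<-trans
      (count-mono (low? (updateAt y j suc) j) (high? y j) λ {l} lt →
        ℕ.≤-trans (ℕ.+-monoˡ-≤ (θ j l) (≤-raise y j l))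
          (ℕ.s≤s⁻¹ (subst (updateAt y j suc l ℕ.+ θ j l ℕ.<_) (updateAt-updates j y) lt)))
      high<f)
    ... | no i≢j with minimal i
    ...   | inj₁ yi≡0 = inj₁ (trans (updateAt-minimal i j y i≢j) yi≡0)
    ...   | inj₂ low<f = inj₂ (ℕ.≤-<-trans
      (count-mono (low? (updateAt y j suc) i) (low? y i) λ {l} lt →
        ℕ.≤-<-trans (ℕ.+-monoˡ-≤ (θ i l) (≤-raise y j l))
          (subst (updateAt y j suc l ℕ.+ θ i l ℕ.<_) (updateAt-minimal i j y i≢j) lt))
      low<f)

    module _ {y : Fin n → ℕ} (minimal : Minimal y) where

      low≤f : ∀ j → count (low? y j) ℕ.≤ f j
      low≤f j with minimal j
      ... | inj₂ low<f = ℕ.<⇒≤ low<f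
      ... | inj₁ yj≡0 = ℕ.≤-trans (count≤ (low? y j) toℕ (λ _ _ → Fin.toℕ-injective)
              (λ {i} lt → contradiction (subst (y i ℕ.+ θ j i ℕ.<_) yj≡0 lt) λ ())) z≤n

      -- Otherwise Hall's condition fails for the set of all j with y j > v.
      no-gap : ∀ v j → v ℕ.≤ y j → v ℕ.≤ count (λ i → y i ℕ.<? v)
      no-gap zero    j v≤yj = z≤n
      no-gap (suc v) j v<yj with Fin.any? (λ i → y i ℕ.≟ v)
      ... | yes (i , yi≡v) = ℕ.≤-<-trans (no-gap v j (ℕ.<⇒≤ v<yj))
        (count-strict (λ i → y i ℕ.<? v) (λ i → y i ℕ.<? suc v) ℕ.m<n⇒m<1+n
          {i} (ℕ.≤-reflexive (cong suc yi≡v)) (λ yi<v → ℕ.<-irrefl yi≡v yi<v))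
      ... | no gap with hall (λ i → v ℕ.<? y i) (j , v<yj)
      ...   | i , v<yi , fi≤ with minimal i
      ...     | inj₁ yi≡0 = contradiction (subst (v ℕ.<_) yi≡0 v<yi) λ ()
      ...     | inj₂ low<fi = contradiction
        (ℕ.≤-trans fi≤ (count-mono (λ l → ¬? (v ℕ.<? y l)) (low? y i) λ {l} yl≯v →
          ℕ.≤-<-trans (ℕ.+-monoʳ-≤ (y l) (θ≤1 i l)) (ℕ.≤-<-trans
            (ℕ.≤-trans (ℕ.≤-reflexive (ℕ.+-comm (y l) 1))
              (ℕ.≤∧≢⇒< (ℕ.≮⇒≥ yl≯v) λ yl≡v → gap (l , yl≡v))) v<yi)))
        (ℕ.<⇒≱ low<fi)

      -- Every level below `y j` is occupied, and distinct levels by distinct coordinates.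
      minimal≤n : ∀ j → y j ℕ.≤ n
      minimal≤n j = ℕ.≤-trans (no-gap (y j) j ℕ.≤-refl) (count≤n _)

    -- Each raise increases the sum of the heights by one, and `minimal≤n` bounds that sum by n · n,
    -- so the fuel cannot run out.
    balance : ∀ fuel y → Minimal y → n ℕ.* n ℕ.< sum y ℕ.+ fuel → ∃ Balanced
    balance zero    y minimal enough = contradiction (sum≤ y (minimal≤n minimal))
      (ℕ.<⇒≱ (subst (n ℕ.* n ℕ.<_) (ℕ.+-identityʳ _) enough))
    balance (suc fuel) y minimal enough with Fin.any? (λ j → count (high? y j) ℕ.<? f j)
    ... | no none = y , λ j → low≤f minimal j , ℕ.≮⇒≥ λ high<f → none (j , high<f)
    ... | yes (j , high<f) = balance fuel (updateAt y j suc) (raise-minimal j minimal high<f)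
      (subst (n ℕ.* n ℕ.<_) (trans (ℕ.+-suc _ fuel) (cong (ℕ._+ fuel) (sym (sum-suc y j)))) enough)

  balanced : ∃ Balanced
  balanced = balance (suc (n ℕ.* n)) (const 0) (λ _ → inj₁ refl) (ℕ.m≤n+m _ (sum {n} (const 0)))

-- Breaking the ties by successive insertion.

module _ {P : Pred (Fin n) 0ℓ} (P? : Decidable P) (δ : Fin n → ℕ)
  (injective : ∀ {i l} → P i → P l → δ i ≡ δ l → i ≡ l) where

  private
    below? : ∀ q → Decidable (λ i → P i × δ i ℕ.< q)
    below? q i = P? i ×-dec (δ i ℕ.<? q)

    at? : ∀ q → Decidable (λ i → P i × δ i ≡ q)
    at? q i = P? i ×-dec (δ i ℕ.≟ q)

    below-suc : ∀ q → count (below? (suc q)) ℕ.≤ suc (count (below? q))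
    below-suc q = begin
      count (below? (suc q))            ≡⟨ count-disjoint (at? q) (below? q) (below? (suc q))
        (λ _ (_ , eq) (_ , lt) → ℕ.<-irrefl eq lt)
        (λ (p , eq) → p , ℕ.≤-reflexive (cong suc eq)) (λ (p , lt) → p , ℕ.m<n⇒m<1+n lt)
        (λ (p , lt) → [ (λ lt → inj₂ (p , lt)) , (λ eq → inj₁ (p , eq)) ]′ (ℕ.m<1+n⇒m<n∨m≡n lt)) ⟨
      count (at? q) ℕ.+ count (below? q)  ≤⟨ ℕ.+-monoˡ-≤ _ (count≤ (at? q) {1} (const 0)
        (λ (p , eq) (p′ , eq′) _ → injective p p′ (trans eq (sym eq′))) (λ _ → s≤s z≤n)) ⟩
      suc (count (below? q))            ∎
      where open ℕ.≤-Reasoning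

    search : ∀ {k} q → k ℕ.≤ count (below? q) → ∃[ r ] count (below? r) ≡ k
    search {k} zero k≤ = 0 , ℕ.≤-antisym
      (ℕ.≤-trans (count≤ (below? 0) {0} (const 0) (λ { (_ , ()) }) (λ { (_ , ()) })) z≤n) k≤
    search {k} (suc q) k≤ with k ℕ.≤? count (below? q)
    ... | yes k≤′ = search q k≤′
    ... | no k≰ = suc q , ℕ.≤-antisym (ℕ.≤-trans (below-suc q) (ℕ.≰⇒> k≰)) k≤

  -- A discrete intermediate value argument: as δ is injective on P, moving the threshold up by one
  -- adds at most one element.
  cut : ∀ {k} → k ℕ.≤ count P? → ∃[ q ] count (below? q) ≡ k
  cut k≤ = search (suc (sum δ)) (ℕ.≤-trans k≤
    (count-mono P? (below? (suc (sum δ))) λ p → p , s≤s (≤sum δ _)))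

-- Opens a gap at q without disturbing the order, so that q becomes free for a new element.
shift : ℕ → ℕ → ℕ
shift q d with d ℕ.<? q
... | yes _ = d
... | no _  = suc d

module _ (q : ℕ) where

  shift-mono : ∀ {d e} → d ℕ.< e → shift q d ℕ.< shift q e
  shift-mono {d} {e} d<e with d ℕ.<? q | e ℕ.<? q
  ... | yes _   | yes _   = d<e
  ... | yes _   | no _    = ℕ.m<n⇒m<1+n d<e
  ... | no d≮q  | yes e<q = contradiction (ℕ.<-trans d<e e<q) d≮q
  ... | no _    | no _    = s≤s d<e

  shift-cancel : ∀ {d e} → shift q d ℕ.< shift q e → d ℕ.< e
  shift-cancel {d} {e} lt with ℕ.<-cmp d e
  ... | tri< d<e _ _  = d<e
  ... | tri≈ _ refl _ = contradiction lt (ℕ.<-irrefl refl)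
  ... | tri> _ _ e<d  = contradiction lt (ℕ.<-asym (shift-mono e<d))

  shift-injective : ∀ {d e} → shift q d ≡ shift q e → d ≡ e
  shift-injective {d} {e} eq with ℕ.<-cmp d e
  ... | tri< d<e _ _ = contradiction eq (ℕ.<⇒≢ (shift-mono d<e))
  ... | tri≈ _ d≡e _ = d≡e
  ... | tri> _ _ e<d = contradiction (sym eq) (ℕ.<⇒≢ (shift-mono e<d))

  shift<-intro : ∀ {d} → d ℕ.< q → shift q d ℕ.< q
  shift<-intro {d} d<q with d ℕ.<? q
  ... | yes _  = d<q
  ... | no d≮q = contradiction d<q d≮q

  shift<-elim : ∀ {d} → shift q d ℕ.< q → d ℕ.< q
  shift<-elim {d} lt with d ℕ.<? q
  ... | yes d<q = d<q
  ... | no d≮q  = contradiction (ℕ.m+n≤o⇒n≤o 1 lt) d≮q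

  shift≢ : ∀ {d} → shift q d ≢ q
  shift≢ {d} eq with d ℕ.<? q
  ... | yes d<q = ℕ.<⇒≢ d<q eq
  ... | no d≮q  = d≮q (ℕ.≤-reflexive eq)

module _ (y : Fin n → ℕ) (goal : Fin n → ℕ) (goal≤ : ∀ j → goal j ℕ.≤ count (tight? y j)) where

  private
    -- The order of insertion: lexicographic by height, then index. A tight i either has the height
    -- of j and a smaller index, or is one level lower; so it always comes before j.
    rank : Fin n → ℕ
    rank j = y j ℕ.* n ℕ.+ toℕ j

    rank-injective : ∀ {i j} → rank i ≡ rank j → i ≡ j
    rank-injective {i} {j} eq = Fin.toℕ-injective (proj₂ (lex-≡ {a = y i} {y j} (Fin.toℕ<n _) (Fin.toℕ<n _) eq))

    tight⇒rank< : ∀ {j i} → y i ℕ.+ θ j i ≡ y j → rank i ℕ.< rank j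
    tight⇒rank< {j} {i} eq with ℕ.<-≤-connex (toℕ i) (toℕ j)
    ... | inj₁ i<j = subst (λ v → rank i ℕ.< v ℕ.* n ℕ.+ toℕ j)
      (trans (sym (ℕ.+-identityʳ (y i))) (trans (cong (y i ℕ.+_) (sym (θ≡0 i<j))) eq))
      (ℕ.+-monoʳ-< (y i ℕ.* n) i<j)
    ... | inj₂ j≤i = lex-< {a = y i} {y j} (ℕ.≤-reflexive
      (trans (ℕ.+-comm 1 (y i)) (trans (cong (y i ℕ.+_) (sym (θ≡1 j≤i))) eq))) (Fin.toℕ<n i)

    Stage : ℕ → (Fin n → ℕ) → Set
    Stage r δ = (∀ {i l} → rank i ℕ.< r → rank l ℕ.< r → δ i ≡ δ l → i ≡ l)
              × (∀ j → rank j ℕ.< r → count (before? y j δ) ≡ goal j)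

    module Insert {δ δ′ : Fin n → ℕ} {j : Fin n} {q : ℕ} (at-j : δ′ j ≡ q)
      (others : ∀ i → i ≢ j → δ′ i ≡ shift q (δ i)) where

      old : ∀ {i} → rank i ℕ.< rank j → δ′ i ≡ shift q (δ i)
      old {i} i< = others i λ i≡j → ℕ.<-irrefl (cong rank i≡j) i<

      split : ∀ {i} → rank i ℕ.< suc (rank j) → rank i ℕ.< rank j ⊎ i ≡ j
      split i< = [ inj₁ , inj₂ ∘ rank-injective ]′ (ℕ.m<1+n⇒m<n∨m≡n i<)

      injective : (∀ {i l} → rank i ℕ.< rank j → rank l ℕ.< rank j → δ i ≡ δ l → i ≡ l) →
        ∀ {i l} → rank i ℕ.< suc (rank j) → rank l ℕ.< suc (rank j) → δ′ i ≡ δ′ l → i ≡ l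
      injective inj i< l< eq with split i< | split l<
      ... | inj₁ i<   | inj₁ l<   = inj i< l< (shift-injective q (trans (sym (old i<)) (trans eq (old l<))))
      ... | inj₁ i<   | inj₂ refl = contradiction (trans (sym (old i<)) (trans eq at-j)) (shift≢ q)
      ... | inj₂ refl | inj₁ l<   = contradiction (trans (sym (old l<)) (trans (sym eq) at-j)) (shift≢ q)
      ... | inj₂ refl | inj₂ refl = refl

      -- All points tight at l were placed even before l, and `shift` preserves their order.
      before-old : ∀ l → rank l ℕ.< rank j → count (before? y l δ′) ≡ count (before? y l δ)
      before-old l l< = count-cong (before? y l δ′) (before? y l δ)
        (λ {i} (t , lt) → t , shift-cancel q (subst₂ ℕ._<_ (old (ℕ.<-trans (tight⇒rank< t) l<)) (old l<) lt))
        (λ {i} (t , lt) → t , subst₂ ℕ._<_ (sym (old (ℕ.<-trans (tight⇒rank< t) l<))) (sym (old l<)) (shift-mono q lt))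

      before-new : count (before? y j δ′) ≡ count (λ i → tight? y j i ×-dec (δ i ℕ.<? q))
      before-new = count-cong (before? y j δ′) (λ i → tight? y j i ×-dec (δ i ℕ.<? q))
        (λ {i} (t , lt) → t , shift<-elim q (subst₂ ℕ._<_ (old (tight⇒rank< t)) at-j lt))
        (λ {i} (t , lt) → t , subst₂ ℕ._<_ (sym (old (tight⇒rank< t))) (sym at-j) (shift<-intro q lt))

    -- When j is inserted, the points tight at j already have distinct places; `cut` finds the place
    -- with exactly `goal j` of them below it. If r is the rank of no coordinate, nothing is to be
    -- done.
    next : ∀ r {δ} → Stage r δ → ∃ (Stage (suc r))
    next r {δ} (inj , good) with Fin.any? (λ j → rank j ℕ.≟ r)
    ... | no none = δ , (λ i< l< → inj (old i<) (old l<)) , λ j j< → good j (old j<)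
      where
      old : ∀ {i} → rank i ℕ.< suc r → rank i ℕ.< r
      old i< = ℕ.≤∧≢⇒< (ℕ.s≤s⁻¹ i<) λ eq → none (_ , eq)
    ... | yes (j , refl)
      with q , q-cuts ← cut (tight? y j) δ (λ t t′ → inj (tight⇒rank< t) (tight⇒rank< t′)) (goal≤ j)
      = updateAt (shift q ∘ δ) j (const q) , I.injective inj
      , λ l l< → [ (λ l< → trans (I.before-old l l<) (good l l<)) , (λ { refl → trans I.before-new q-cuts }) ]′
          (I.split l<)
      where module I = Insert {δ = δ} (updateAt-updates j (shift q ∘ δ))
                         (λ i → updateAt-minimal i j (shift q ∘ δ))

    stage : ∀ r → ∃ (Stage r)
    stage zero    = const 0 , (λ ()) , λ _ ()
    stage (suc r) = next r (proj₂ (stage r))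

  arrange : ∃[ δ ] ((∀ {i l} → δ i ≡ δ l → i ≡ l) × (∀ j → count (before? y j δ) ≡ goal j))
  arrange with stage (suc (sum rank))
  ... | δ , inj , good = δ , inj (s≤s (≤sum rank _)) (s≤s (≤sum rank _)) , λ j → good j (s≤s (≤sum rank j))

-- Natural numbers and fractions inside the rationals.

ι-+ : ∀ k l → ι (k ℕ.+ l) ≡ ι k ℚ.+ ι l
ι-+ zero    l = sym (ℚ.+-identityˡ (ι l))
ι-+ (suc k) l = trans (cong (1ℚ ℚ.+_) (ι-+ k l)) (sym (ℚ.+-assoc 1ℚ (ι k) (ι l)))

ι-* : ∀ k l → ι (k ℕ.* l) ≡ ι k ℚ.* ι l
ι-* zero    l = sym (ℚ.*-zeroˡ (ι l))
ι-* (suc k) l = begin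
  ι (l ℕ.+ k ℕ.* l)                   ≡⟨ ι-+ l (k ℕ.* l) ⟩
  ι l ℚ.+ ι (k ℕ.* l)               ≡⟨ cong₂ ℚ._+_ (sym (ℚ.*-identityˡ (ι l))) (ι-* k l) ⟩
  1ℚ ℚ.* ι l ℚ.+ ι k ℚ.* ι l      ≡⟨ ℚ.*-distribʳ-+ (ι l) 1ℚ (ι k) ⟨
  (1ℚ ℚ.+ ι k) ℚ.* ι l            ∎
  where open ≡-Reasoning

ι-strict : ∀ {k l} → k ℕ.< l → ι k ℚ.< ι l
ι-strict {k} {l} k<l = ℚ.<-≤-trans
  (subst (ℚ._< 1ℚ ℚ.+ ι k) (ℚ.+-identityˡ (ι k)) (ℚ.+-monoˡ-< (ι k) (ℚ.positive⁻¹ 1ℚ))) (ι-mono k<l)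

module _ (N : ℕ) where

  private
    instance
      N-pos : ℚ.Positive (ι (suc N))
      N-pos = ℚ.positive (ι-strict {0} {suc N} (s≤s z≤n))
      N-nonZero : ℚ.NonZero (ι (suc N))
      N-nonZero = ℚ.pos⇒nonZero (ι (suc N))

    ρ : ℚ
    ρ = ℚ.1/ ι (suc N)

    instance
      ρ-pos : ℚ.Positive ρ
      ρ-pos = ℚ.1/pos⇒pos (ι (suc N))

  fraction : ℕ → ℚ
  fraction k = ι k ℚ.* ρ

  fraction-+ : ∀ k t → fraction k ℚ.+ ι t ≡ fraction (k ℕ.+ t ℕ.* suc N)
  fraction-+ k t = begin
    ι k ℚ.* ρ ℚ.+ ι t                            ≡⟨ cong (ι k ℚ.* ρ ℚ.+_) (ℚ.*-identityʳ (ι t)) ⟨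
    ι k ℚ.* ρ ℚ.+ ι t ℚ.* 1ℚ                     ≡⟨ cong (λ z → ι k ℚ.* ρ ℚ.+ ι t ℚ.* z) (ℚ.*-inverseʳ (ι (suc N))) ⟨
    ι k ℚ.* ρ ℚ.+ ι t ℚ.* (ι (suc N) ℚ.* ρ)      ≡⟨ cong (ι k ℚ.* ρ ℚ.+_) (ℚ.*-assoc (ι t) (ι (suc N)) ρ) ⟨
    ι k ℚ.* ρ ℚ.+ ι t ℚ.* ι (suc N) ℚ.* ρ        ≡⟨ ℚ.*-distribʳ-+ ρ (ι k) (ι t ℚ.* ι (suc N)) ⟨
    (ι k ℚ.+ ι t ℚ.* ι (suc N)) ℚ.* ρ            ≡⟨ cong (λ z → (ι k ℚ.+ z) ℚ.* ρ) (ι-* t (suc N)) ⟨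
    (ι k ℚ.+ ι (t ℕ.* suc N)) ℚ.* ρ                ≡⟨ cong (ℚ._* ρ) (ι-+ k (t ℕ.* suc N)) ⟨
    ι (k ℕ.+ t ℕ.* suc N) ℚ.* ρ                      ∎
    where open ≡-Reasoning

  fraction-strict : ∀ {k l} → k ℕ.< l → fraction k ℚ.< fraction l
  fraction-strict k<l = ℚ.*-monoˡ-<-pos ρ (ι-strict k<l)

  fraction-cancel : ∀ {k l} → fraction k ℚ.< fraction l → k ℕ.< l
  fraction-cancel {k} {l} lt = ℕ.≰⇒> λ l≤k → <⇒≱ lt (ℚ.*-monoʳ-≤-nonNeg ρ {{ℚ.pos⇒nonNeg ρ}} (ι-mono l≤k))

  fraction-injective : ∀ {k l} → fraction k ≡ fraction l → k ≡ l
  fraction-injective {k} {l} eq with ℕ.<-cmp k l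
  ... | tri< k<l _ _ = contradiction eq (ℚ.<⇒≢ (fraction-strict k<l))
  ... | tri≈ _ k≡l _ = k≡l
  ... | tri> _ _ l<k = contradiction (sym eq) (ℚ.<⇒≢ (fraction-strict l<k))

-- The point is y j + δ j / (N + 1): the heights decide every comparison that is not a tie, and the
-- fractional parts decide the ties. The row of j is its low set together with the
-- `f j ∸ count (low? y j)` ties placed before j.
label-surjective : {f : Fin n → ℕ} → Hall f → ∃[ x ] (Generic x × label x ≗ f)
label-surjective {n} {f} hall with balanced f hall
... | y , bal with arrange y (λ j → f j ℕ.∸ count (low? y j)) (λ j →
    ℕ.m≤n+o⇒m∸n≤o (f j) (count (low? y j)) (ℕ.≤-trans (proj₂ (bal j)) (ℕ.≤-reflexive (sym
      (count-disjoint (low? y j) (tight? y j) (high? y j) (λ _ lt eq → ℕ.<⇒≢ lt eq)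
        ℕ.<⇒≤ ℕ.≤-reflexive ℕ.m≤n⇒m<n∨m≡n)))))
... | δ , δ-injective , before≡ = x , generic , label≡
  where
  N = sum δ
  δ<N : ∀ i → δ i ℕ.< suc N
  δ<N i = s≤s (≤sum δ i)
  X : Fin n → ℕ
  X j = y j ℕ.* suc N ℕ.+ δ j
  x : Fin n → ℚ
  x = fraction N ∘ X
  shifted : ∀ j i → x i ℚ.+ ι (θ j i) ≡ fraction N ((y i ℕ.+ θ j i) ℕ.* suc N ℕ.+ δ i)
  shifted j i = trans (fraction-+ N (X i) (θ j i)) (cong (fraction N) (begin
    y i ℕ.* suc N ℕ.+ δ i ℕ.+ θ j i ℕ.* suc N   ≡⟨ ℕ.+-assoc (y i ℕ.* suc N) (δ i) _ ⟩
    y i ℕ.* suc N ℕ.+ (δ i ℕ.+ θ j i ℕ.* suc N) ≡⟨ cong (y i ℕ.* suc N ℕ.+_) (ℕ.+-comm (δ i) _) ⟩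
    y i ℕ.* suc N ℕ.+ (θ j i ℕ.* suc N ℕ.+ δ i) ≡⟨ ℕ.+-assoc (y i ℕ.* suc N) _ (δ i) ⟨
    y i ℕ.* suc N ℕ.+ θ j i ℕ.* suc N ℕ.+ δ i   ≡⟨ cong (ℕ._+ δ i) (ℕ.*-distribʳ-+ (suc N) (y i) (θ j i)) ⟨
    (y i ℕ.+ θ j i) ℕ.* suc N ℕ.+ δ i         ∎))
    where open ≡-Reasoning
  generic : Generic x
  generic j i eq with lex-≡ {a = y j} {y i ℕ.+ θ j i} (δ<N j) (δ<N i) (fraction-injective N (trans eq (shifted j i)))
  ... | yj≡ , δj≡δi with δ-injective δj≡δi
  -- Equal fractional parts force i = j, and since θ j j = 1 the heights would satisfy y j = y j +
  -- 1.
  ...   | refl = ℕ.m≢1+m+n (y j) {0} (trans yj≡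
    (trans (cong (y j ℕ.+_) (θ≡1 {j = j} ℕ.≤-refl)) (ℕ.+-suc (y j) 0)))
  label≡ : label x ≗ f
  label≡ j = begin
    label x j                                                 ≡⟨ count-disjoint (low? y j) (before? y j δ) (x ⊢ j ▷?_)
      (λ _ lt (eq , _) → ℕ.<⇒≢ lt eq)
      (λ {i} lt → ▷-intro (lex-< lt (δ<N i)))
      (λ {i} (eq , lt) → ▷-intro (subst (λ v → v ℕ.* suc N ℕ.+ δ i ℕ.< X j) (sym eq) (ℕ.+-monoʳ-< (y j ℕ.* suc N) lt)))
      (λ {i} j▷i → lex-cancel (δ<N i) (δ<N j) (fraction-cancel N (subst (ℚ._< x j) (shifted j i) j▷i))) ⟨
    count (low? y j) ℕ.+ count (before? y j δ)              ≡⟨ cong (count (low? y j) ℕ.+_) (before≡ j) ⟩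
    count (low? y j) ℕ.+ (f j ℕ.∸ count (low? y j))               ≡⟨ ℕ.m+[n∸m]≡n (proj₁ (bal j)) ⟩
    f j                                                       ∎
    where
    open ≡-Reasoning
    ▷-intro : ∀ {i} → (y i ℕ.+ θ j i) ℕ.* suc N ℕ.+ δ i ℕ.< X j → x ⊢ j ▷ i
    ▷-intro {i} lt = subst (ℚ._< x j) (sym (shifted j i)) (fraction-strict N lt)

open +-*-Solver

private
  variable
    p q r s η ε c : ℚ

-- Open convex sets are connected

-- Linear inequalities are certified in this form: the difference is written as a combination of
-- nonnegative terms, and the ring solver checks the identity.
≤-by : ∀ d → 0ℚ ℚ.≤ d → p ℚ.+ d ≡ q → p ℚ.≤ q
≤-by {p} d 0≤d refl = subst (ℚ._≤ p ℚ.+ d) (ℚ.+-identityʳ p) (ℚ.+-monoʳ-≤ p 0≤d)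

<-by : ∀ d → 0ℚ ℚ.< d → p ℚ.+ d ≡ q → p ℚ.< q
<-by {p} d 0<d refl = subst (ℚ._< p ℚ.+ d) (ℚ.+-identityʳ p) (ℚ.+-monoʳ-< p 0<d)

0≤diff : p ℚ.≤ q → 0ℚ ℚ.≤ q ℚ.- p
0≤diff {p} {q} p≤q = subst (ℚ._≤ q ℚ.- p) (ℚ.+-inverseʳ p) (ℚ.+-monoˡ-≤ (ℚ.- p) p≤q)

0<diff : p ℚ.< q → 0ℚ ℚ.< q ℚ.- p
0<diff {p} {q} p<q = subst (ℚ._< q ℚ.- p) (ℚ.+-inverseʳ p) (ℚ.+-monoˡ-< (ℚ.- p) p<q)

0≤+ : 0ℚ ℚ.≤ p → 0ℚ ℚ.≤ q → 0ℚ ℚ.≤ p ℚ.+ q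
0≤+ = ℚ.+-mono-≤

0<+ : 0ℚ ℚ.< p → 0ℚ ℚ.< q → 0ℚ ℚ.< p ℚ.+ q
0<+ = ℚ.+-mono-<

0≤* : 0ℚ ℚ.≤ p → 0ℚ ℚ.≤ q → 0ℚ ℚ.≤ p ℚ.* q
0≤* {p} {q} 0≤p 0≤q = subst (ℚ._≤ p ℚ.* q) (ℚ.*-zeroˡ q)
  (ℚ.*-monoʳ-≤-nonNeg q {{ℚ.nonNegative 0≤q}} 0≤p)

0<half : 0ℚ ℚ.< ε → 0ℚ ℚ.< ½ ℚ.* ε
0<half = ℚ.*-monoʳ-<-pos ½

p≤∣p∣ : ∀ p → p ℚ.≤ ∣ p ∣
p≤∣p∣ p with ℚ.≤-total 0ℚ p
... | inj₁ 0≤p = ℚ.≤-reflexive (sym (ℚ.0≤p⇒∣p∣≡p 0≤p))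
... | inj₂ p≤0 = ℚ.≤-trans p≤0 (ℚ.0≤∣p∣ p)

-p≤∣p∣ : ∀ p → ℚ.- p ℚ.≤ ∣ p ∣
-p≤∣p∣ p = subst (ℚ.- p ℚ.≤_) (ℚ.∣-p∣≡∣p∣ p) (p≤∣p∣ (ℚ.- p))

∣p∣≤ : p ℚ.≤ q → ℚ.- p ℚ.≤ q → ∣ p ∣ ℚ.≤ q
∣p∣≤ {p} p≤q -p≤q with ℚ.∣p∣≡p∨∣p∣≡-p p
... | inj₁ eq = ℚ.≤-trans (ℚ.≤-reflexive eq) p≤q
... | inj₂ eq = ℚ.≤-trans (ℚ.≤-reflexive eq) -p≤q

toℚᵘ-ι : ∀ k → toℚᵘ (ι k) ℚᵘ.≃ mkℚᵘ (+ k) 0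
toℚᵘ-ι zero    = ℚᵘ.≃-refl
toℚᵘ-ι (suc k) = ℚᵘ.≃-trans (ℚ.toℚᵘ-homo-+ 1ℚ (ι k))
  (ℚᵘ.≃-trans (ℚᵘ.+-congʳ (toℚᵘ 1ℚ) (toℚᵘ-ι k)) (*≡* (cong (λ z → (+ 1 ℤ.+ z) ℤ.* + 1) (ℤ.*-identityʳ (+ k)))))

-- A nonnegative fraction is at most its numerator.
archimedean : ∀ p → ∃[ k ] p ℚ.≤ ι k
archimedean p@(mkℚ ℤ.-[1+ _ ] _ _) = 0 , ℚ.<⇒≤ (ℚ.negative⁻¹ p)
archimedean p@(mkℚ (+ k) d _) = k , ℚ.toℚᵘ-cancel-≤ (ℚᵘ.≤-trans
  (*≤* (ℤ.*-monoˡ-≤-nonNeg (+ k) (ℤ.+≤+ (s≤s z≤n)))) (ℚᵘ.≤-reflexive (ℚᵘ.≃-sym (toℚᵘ-ι k))))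

bounded : (v : Fin n → ℚ) → ∃[ k ] ∀ l → v l ℚ.≤ ι k
bounded v = sum (proj₁ ∘ archimedean ∘ v) , λ l →
  ℚ.≤-trans (proj₂ (archimedean (v l))) (ι-mono (≤sum (proj₁ ∘ archimedean ∘ v) l))

width : ℕ → ℚ
width zero    = 1ℚ
width (suc k) = ½ ℚ.* width k

0<width : ∀ k → 0ℚ ℚ.< width k
0<width zero    = ℚ.positive⁻¹ 1ℚ
0<width (suc k) = 0<half (0<width k)

-- Bernoulli's bound k + 1 ≤ 2^k, stated without division.
width*ι≤1 : ∀ k → width k ℚ.* ι (suc k) ℚ.≤ 1ℚ
width*ι≤1 zero    = ℚ.≤-refl
width*ι≤1 (suc k) = ≤-by (½ ℚ.* (width k ℚ.* ι k) ℚ.+ (1ℚ ℚ.- width k ℚ.* ι (suc k)))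
  (0≤+ (0≤* (ℚ.<⇒≤ (ℚ.positive⁻¹ ½)) (0≤* (ℚ.<⇒≤ (0<width k)) (ι-nonNeg k))) (0≤diff (width*ι≤1 k)))
  (solve 2 (λ w i → con ½ :* w :* (con 1ℚ :+ (con 1ℚ :+ i)) :+ (con ½ :* (w :* i) :+ (con 1ℚ :- w :* (con 1ℚ :+ i))) := con 1ℚ)
    refl (width k) (ι k))

width-small : ∀ c → 0ℚ ℚ.< ε → ∃[ k ] width k ℚ.* ι c ℚ.< ε
width-small {ε} c 0<ε = N , (begin-strict
  width N ℚ.* ι c                       ≡⟨ ℚ.*-identityʳ _ ⟨
  width N ℚ.* ι c ℚ.* 1ℚ                ≡⟨ cong (width N ℚ.* ι c ℚ.*_) (ℚ.*-inverseˡ ε) ⟨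
  width N ℚ.* ι c ℚ.* (ε⁻¹ ℚ.* ε)       ≡⟨ solve 4 (λ w i e f → w :* i :* (e :* f) := w :* (i :* e) :* f) refl (width N) (ι c) ε⁻¹ ε ⟩
  width N ℚ.* (ι c ℚ.* ε⁻¹) ℚ.* ε       <⟨ ℚ.*-monoˡ-<-pos ε (ℚ.*-monoʳ-<-pos (width N) {{ℚ.positive (0<width N)}}
    (ℚ.≤-<-trans (proj₂ (archimedean (ι c ℚ.* ε⁻¹))) (ι-strict {N} ℕ.≤-refl))) ⟩
  width N ℚ.* ι (suc N) ℚ.* ε           ≤⟨ ℚ.*-monoʳ-≤-nonNeg ε (width*ι≤1 N) ⟩
  1ℚ ℚ.* ε                              ≡⟨ ℚ.*-identityˡ ε ⟩
  ε                                     ∎)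
  where
  open ℚ.≤-Reasoning
  instance
    _ : ℚ.Positive ε
    _ = ℚ.positive 0<ε
    _ : ℚ.NonNegative ε
    _ = ℚ.nonNegative (ℚ.<⇒≤ 0<ε)
    _ : ℚ.NonZero ε
    _ = ℚ.pos⇒nonZero ε
  ε⁻¹ : ℚ
  ε⁻¹ = ℚ.1/ ε
  N = proj₁ (archimedean (ι c ℚ.* ε⁻¹))

-- The order of the reals demands a rational gap; closeness within ε/2 leaves the other half of ε
-- for it.
close⇒ball : (x y : Point n) → 0ℚ ℚ.< ε →
  (∀ l → ∃[ N ] ∀ k → N ℕ.≤ k → ∣ seq (y l) k ℚ.- seq (x l) k ∣ ℚ.< ½ ℚ.* ε) → Ball x ε y
close⇒ball {ε = ε} x y 0<ε close l =
    (½ ℚ.* ε , 0<half 0<ε , proj₁ (close l) , λ k N≤k → <-by _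
      (0<diff (ℚ.≤-<-trans (-p≤∣p∣ (seq (y l) k ℚ.- seq (x l) k)) (proj₂ (close l) k N≤k)))
      (solve 2 (λ e d → :- e :+ con ½ :* e :+ (con ½ :* e :- (:- d)) := d) refl ε (seq (y l) k ℚ.- seq (x l) k)))
  , (½ ℚ.* ε , 0<half 0<ε , proj₁ (close l) , λ k N≤k → ℚ.<-≤-trans
      (ℚ.+-monoˡ-< (½ ℚ.* ε) (ℚ.≤-<-trans (p≤∣p∣ (seq (y l) k ℚ.- seq (x l) k)) (proj₂ (close l) k N≤k)))
      (ℚ.≤-reflexive (solve 1 (λ e → con ½ :* e :+ con ½ :* e := e) refl ε)))

ball-mono : (x : Point n) → η ℚ.≤ ε → Ball x η ⊆ Ball x ε
ball-mono x η≤ε near l with near l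
... | (μ , 0<μ , M , lower) , (ν , 0<ν , N , upper) =
    (μ , 0<μ , M , λ k M≤k → ℚ.≤-<-trans (ℚ.+-monoˡ-≤ μ (ℚ.neg-antimono-≤ η≤ε)) (lower k M≤k))
  , (ν , 0<ν , N , λ k N≤k → ℚ.<-≤-trans (upper k N≤k) η≤ε)

-- A predicate on representations need not respect equality of reals. An open one does here, because
-- y lies in every ball about x.
open-resp : {A : Pred (Point n) 0ℓ} → IsOpen A → (x y : Point n) →
  (∀ l k → seq (x l) k ≡ seq (y l) k) → A x → A y
open-resp A-open x y x≗y Ax with A-open x Ax
... | ε , 0<ε , ball⊆A = ball⊆A {y} (close⇒ball x y 0<ε λ l → 0 , λ k _ →
  ℚ.≤-<-trans (ℚ.≤-reflexive (cong ∣_∣ (trans (cong (ℚ._- seq (x l) k) (sym (x≗y l k))) (ℚ.+-inverseʳ (seq (x l) k)))))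
    (0<half 0<ε))

open-∩ : {A B : Pred (Point n) 0ℓ} → IsOpen A → IsOpen B → IsOpen (A ∩ B)
open-∩ A-open B-open x (Ax , Bx) with A-open x Ax | B-open x Bx
... | ε , 0<ε , ε⊆A | η , 0<η , η⊆B with ℚ.≤-total ε η
...   | inj₁ ε≤η = ε , 0<ε , λ {y} near → ε⊆A {y} near , η⊆B {y} (ball-mono x ε≤η {y} near)
...   | inj₂ η≤ε = η , 0<η , λ {y} near → ε⊆A {y} (ball-mono x η≤ε {y} near) , η⊆B {y} near

open-⋂ : {A : Fin m → Pred (Point n) 0ℓ} → (∀ i → IsOpen (A i)) → IsOpen (λ x → ∀ i → A i x)
open-⋂ {zero}  A-open x Ax = 1ℚ , ℚ.positive⁻¹ 1ℚ , λ _ ()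
open-⋂ {suc m} A-open x Ax
  with ε , 0<ε , ball⊆ ← open-∩ (A-open zero) (open-⋂ (A-open ∘ suc)) x (Ax zero , Ax ∘ suc)
  = ε , 0<ε , λ {y} near → λ { zero → proj₁ (ball⊆ {y} near) ; (suc i) → proj₂ (ball⊆ {y} near) i }

rational-point : {A : Pred (Point n) 0ℓ} → IsOpen A → ∃ A → ∃[ q ] A (fromℚ ∘ q)
rational-point A-open (x , Ax) with A-open x Ax
... | ε , 0<ε , ball⊆A = x′ , ball⊆A {fromℚ ∘ x′} (close⇒ball x (fromℚ ∘ x′) 0<ε λ l →
  proj₁ (modulus l) , λ k N≤k → proj₂ (modulus l) _ k ℕ.≤-refl N≤k)
  where
  modulus = λ l → cauchy (x l) (½ ℚ.* ε) (0<half 0<ε)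
  x′ = λ l → seq (x l) (proj₁ (modulus l))

onSegment : (Fin n → ℚ) → (Fin n → ℚ) → ℚ → Fin n → ℚ
onSegment a b t l = a l ℚ.+ t ℚ.* (b l ℚ.- a l)

-- The parameter t may vary along the sequence, so limits of points of the segment
-- are included; C being open, this is not automatic.
Convex : Pred (Point n) 0ℓ → Set
Convex {n} C = (a b : Fin n → ℚ) → C (fromℚ ∘ a) → C (fromℚ ∘ b) →
  {t : ℕ → ℚ} → (∀ k → 0ℚ ℚ.≤ t k) → (∀ k → t k ℚ.≤ 1ℚ) →
  (x : Point n) → (∀ l k → seq (x l) k ≡ onSegment a b (t k) l) → C x

∣segment∣≤ : ∀ (a b : Fin n → ℚ) {c w} → (∀ l → ∣ b l ℚ.- a l ∣ ℚ.≤ ι c) →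
  s ℚ.≤ r ℚ.+ w → r ℚ.≤ s ℚ.+ w → ∀ l →
  ∣ onSegment a b s l ℚ.- onSegment a b r l ∣ ℚ.≤ w ℚ.* ι c
∣segment∣≤ {s = s} {r} a b {c} {w} ∣b-a∣≤ s≤ r≤ l = begin
  ∣ onSegment a b s l ℚ.- onSegment a b r l ∣
    ≡⟨ cong ∣_∣ (solve 4 (λ s r a d → (a :+ s :* d) :- (a :+ r :* d) := (s :- r) :* d) refl s r (a l) (b l ℚ.- a l)) ⟩
  ∣ (s ℚ.- r) ℚ.* (b l ℚ.- a l) ∣
    ≡⟨ ℚ.∣p*q∣≡∣p∣*∣q∣ (s ℚ.- r) (b l ℚ.- a l) ⟩
  ∣ s ℚ.- r ∣ ℚ.* ∣ b l ℚ.- a l ∣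
    ≤⟨ ℚ.*-monoˡ-≤-nonNeg ∣ s ℚ.- r ∣ {{ℚ.∣-∣-nonNeg (s ℚ.- r)}} (∣b-a∣≤ l) ⟩
  ∣ s ℚ.- r ∣ ℚ.* ι c
    ≤⟨ ℚ.*-monoʳ-≤-nonNeg (ι c) {{ℚ.nonNegative (ι-nonNeg c)}} (∣p∣≤ {s ℚ.- r} {w}
      (≤-by _ (0≤diff s≤) (solve 3 (λ s r w → (s :- r) :+ (r :+ w :- s) := w) refl s r w))
      (≤-by _ (0≤diff r≤) (solve 3 (λ s r w → :- (s :- r) :+ (s :+ w :- r) := w) refl s r w))) ⟩
  w ℚ.* ι c ∎
  where open ℚ.≤-Reasoning

module _ {C A B : Pred (Point n) 0ℓ} (convex : Convex C) (A-open : IsOpen A) (B-open : IsOpen B)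
  (cover : ∀ x → C x → A x ⊎ B x) (disjoint : ∀ x → C x → ¬ (A x × B x))
  {a b : Fin n → ℚ} (Ca : C (fromℚ ∘ a)) (Cb : C (fromℚ ∘ b))
  where

  private
    P : ℚ → Point n
    P t = fromℚ ∘ onSegment a b t

    C-P : ∀ {t} → 0ℚ ℚ.≤ t → t ℚ.≤ 1ℚ → C (P t)
    C-P {t} 0≤t t≤1 = convex a b Ca Cb {const t} (const 0≤t) (const t≤1) (P t) (λ _ _ → refl)

    ≤-+width : ∀ k t → t ℚ.≤ t ℚ.+ width k
    ≤-+width k t = ≤-by (width k) (ℚ.<⇒≤ (0<width k)) refl

  -- Within any ε of x there is the image of a whole bisection interval, so that both of its ends
  -- are available.
  Reaches : Point n → (ℕ → ℚ) → Set
  Reaches x t = ∀ {ε} → 0ℚ ℚ.< ε →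
    ∃[ N ] ∀ s → s ℚ.≤ t N ℚ.+ width N → t N ℚ.≤ s → Ball x ε (P s)

  module _ (t : ℕ → ℚ) (0≤t : ∀ k → 0ℚ ℚ.≤ t k) (t+w≤1 : ∀ k → t k ℚ.+ width k ℚ.≤ 1ℚ) where

    t≤1 : ∀ k → t k ℚ.≤ 1ℚ
    t≤1 k = ℚ.≤-trans (≤-+width k (t k)) (t+w≤1 k)

    -- Whichever of A and B contains the limit also contains a small interval's ends, one of which
    -- is known to be in the other set.
    limit-absurd : (x : Point n) → C x → Reaches x t →
      (∀ k → A (P (t k))) → (∀ k → B (P (t k ℚ.+ width k))) → ⊥
    limit-absurd x Cx reaches inA inB = [ fromA , fromB ]′ (cover x Cx)
      where
      fromA : ¬ A x
      fromA Ax with ε , 0<ε , ball⊆A ← A-open x Ax with N , hits ← reaches 0<ε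
        = disjoint (P (t N ℚ.+ width N)) (C-P (ℚ.≤-trans (0≤t N) (≤-+width N (t N))) (t+w≤1 N))
            (ball⊆A {P (t N ℚ.+ width N)} (hits _ ℚ.≤-refl (≤-+width N (t N))) , inB N)
      fromB : ¬ B x
      fromB Bx with ε , 0<ε , ball⊆B ← B-open x Bx with N , hits ← reaches 0<ε
        = disjoint (P (t N)) (C-P (0≤t N) (t≤1 N))
            (inA N , ball⊆B {P (t N)} (hits (t N) (≤-+width N (t N)) ℚ.≤-refl))

    module _ (t-lower : ∀ {k l} → k ℕ.≤ l → t k ℚ.≤ t l)
      (t-upper : ∀ {k l} → k ℕ.≤ l → t l ℚ.≤ t k ℚ.+ width k)
      {c} (∣b-a∣≤ : ∀ l → ∣ b l ℚ.- a l ∣ ℚ.≤ ι c)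
      where

      private
        near : ∀ {N s r} → s ℚ.≤ t N ℚ.+ width N → t N ℚ.≤ s → r ℚ.≤ t N ℚ.+ width N → t N ℚ.≤ r →
          ∀ l → ∣ onSegment a b s l ℚ.- onSegment a b r l ∣ ℚ.≤ width N ℚ.* ι c
        near {N} {s} {r} s≤ ≤s r≤ ≤r = ∣segment∣≤ {s = s} {r} a b {c} {width N} ∣b-a∣≤
          (ℚ.≤-trans s≤ (ℚ.+-monoˡ-≤ (width N) ≤r)) (ℚ.≤-trans r≤ (ℚ.+-monoˡ-≤ (width N) ≤s))

        limit : Point n
        limit l .seq k = onSegment a b (t k) l
        limit l .cauchy ε 0<ε = proj₁ (width-small c 0<ε) , λ k m N≤k N≤m → ℚ.≤-<-trans
          (near {s = t k} {t m} (t-upper N≤k) (t-lower N≤k) (t-upper N≤m) (t-lower N≤m) l)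
          (proj₂ (width-small c 0<ε))

        limit-reaches : Reaches limit t
        limit-reaches {ε} 0<ε = N , λ s s≤ ≤s → close⇒ball limit (P s) 0<ε λ l → N , λ k N≤k →
          ℚ.≤-<-trans (near {N} {s} {t k} s≤ ≤s (t-upper N≤k) (t-lower N≤k) l)
            (proj₂ (width-small c (0<half 0<ε)))
          where N = proj₁ (width-small c (0<half 0<ε))

      no-separation : (∀ k → A (P (t k))) → (∀ k → B (P (t k ℚ.+ width k))) → ⊥
      no-separation = limit-absurd limit (convex a b Ca Cb 0≤t t≤1 limit (λ _ _ → refl)) limit-reaches

  module _ (Aa : A (fromℚ ∘ a)) (Bb : B (fromℚ ∘ b)) where

    private
      record State (k : ℕ) : Set where
        field
          t    : ℚ
          0≤t  : 0ℚ ℚ.≤ t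
          t+≤1 : t ℚ.+ width k ℚ.≤ 1ℚ
          inA  : A (P t)
          inB  : B (P (t ℚ.+ width k))

      open State

      start : State 0
      start = record
        { t = 0ℚ ; 0≤t = ℚ.≤-refl ; t+≤1 = ℚ.≤-refl
        ; inA = open-resp A-open (fromℚ ∘ a) (P 0ℚ)
            (λ l _ → solve 2 (λ a b → a := a :+ con 0ℚ :* (b :- a)) refl (a l) (b l)) Aa
        ; inB = open-resp B-open (fromℚ ∘ b) (P (0ℚ ℚ.+ 1ℚ))
            (λ l _ → solve 2 (λ a b → b := a :+ (con 0ℚ :+ con 1ℚ) :* (b :- a)) refl (a l) (b l)) Bb }

      halves : ∀ t w → t ℚ.+ ½ ℚ.* w ℚ.+ ½ ℚ.* w ≡ t ℚ.+ w
      halves = solve 2 (λ t w → t :+ con ½ :* w :+ con ½ :* w := t :+ w) refl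

      -- The cover itself decides which half to keep, so neither a choice principle nor decidability
      -- of A and B enters.
      refine : ∀ {k} (s : State k) → Σ[ s′ ∈ State (suc k) ]
        (t s ℚ.≤ t s′ × t s′ ℚ.+ width (suc k) ℚ.≤ t s ℚ.+ width k)
      refine {k} s = [ (λ Am → record
          { t = mid ; 0≤t = 0≤mid
          ; t+≤1 = subst (ℚ._≤ 1ℚ) (sym (halves (t s) (width k))) (t+≤1 s)
          ; inA = Am ; inB = subst (λ r → B (P r)) (sym (halves (t s) (width k))) (inB s) }
          , ≤-+width (suc k) (t s) , ℚ.≤-reflexive (halves (t s) (width k)))
        , (λ Bm → record
          { t = t s ; 0≤t = 0≤t s ; t+≤1 = mid≤1 ; inA = inA s ; inB = Bm }
          , ℚ.≤-refl , mid≤) ]′ (cover (P mid) (C-P 0≤mid mid≤1))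
        where
        mid = t s ℚ.+ width (suc k)
        mid≤ : mid ℚ.≤ t s ℚ.+ width k
        mid≤ = subst (mid ℚ.≤_) (halves (t s) (width k)) (≤-+width (suc k) mid)
        0≤mid : 0ℚ ℚ.≤ mid
        0≤mid = ℚ.≤-trans (0≤t s) (≤-+width (suc k) (t s))
        mid≤1 : mid ℚ.≤ 1ℚ
        mid≤1 = ℚ.≤-trans mid≤ (t+≤1 s)

      state : ∀ k → State k
      state zero    = start
      state (suc k) = proj₁ (refine (state k))

      nested : ∀ {k l} → k ℕ.≤′ l → t (state k) ℚ.≤ t (state l)
        × t (state l) ℚ.+ width l ℚ.≤ t (state k) ℚ.+ width k
      nested ℕ.≤′-refl = ℚ.≤-refl , ℚ.≤-refl
      nested (ℕ.≤′-step {l} k≤l) =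
          ℚ.≤-trans (proj₁ (nested k≤l)) (proj₁ (proj₂ (refine (state l))))
        , ℚ.≤-trans (proj₂ (proj₂ (refine (state l)))) (proj₂ (nested k≤l))

    bisection : ⊥
    bisection = no-separation (λ k → t (state k)) (λ k → 0≤t (state k)) (λ k → t+≤1 (state k))
      (λ k≤l → proj₁ (nested (ℕ.≤⇒≤′ k≤l)))
      (λ {k} {l} k≤l → ℚ.≤-trans (≤-+width l (t (state l))) (proj₂ (nested (ℕ.≤⇒≤′ k≤l))))
      {proj₁ (bounded λ l → ∣ b l ℚ.- a l ∣)} (proj₂ (bounded λ l → ∣ b l ℚ.- a l ∣))
      (λ k → inA (state k)) (λ k → inB (state k))

-- The given witnesses are real points. Intersecting with the open set C yields rational ones,
-- between which bisection can start.
convex⇒connected : {C : Pred (Point n) 0ℓ} → IsOpen C → Convex C → Connected C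
convex⇒connected C-open convex A B A-open B-open cover disjoint (CA , CB) =
  let a , Ca , Aa = rational-point (open-∩ C-open A-open) CA
      b , Cb , Bb = rational-point (open-∩ C-open B-open) CB
  in bisection convex A-open B-open cover disjoint {a} {b} Ca Cb Aa Bb

-- Cells and regions

-- Lower bounds suffice: x j - x i < c amounts to `Half (- c) i j`.
Half : ℚ → Fin n → Fin n → Pred (Point n) 0ℓ
Half c j i x = fromℚ c < x j - x i

module _ (c : ℚ) (j i : Fin n) where

  half-open : IsOpen (Half c j i)
  -- Two coordinates move by at most ε/4 each, which leaves half of the gap ε.
  half-open x (ε , 0<ε , N , gap) = ½ ℚ.* (½ ℚ.* ε) , 0<half (0<half 0<ε) , λ {y} → inside {y}
    where
    inside : ∀ {y} → Ball x (½ ℚ.* (½ ℚ.* ε)) y → Half c j i y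
    inside {y} ball =
      let (μ , 0<μ , M , lower) , _ = ball j
          _ , (ν , 0<ν , L , upper) = ball i
      in ½ ℚ.* ε , 0<half 0<ε , N ℕ.⊔ (M ℕ.⊔ L) , λ k ≤k →
        let N≤k = ℕ.m⊔n≤o⇒m≤o N (M ℕ.⊔ L) ≤k
            M≤k = ℕ.m⊔n≤o⇒m≤o M L (ℕ.m⊔n≤o⇒n≤o N (M ℕ.⊔ L) ≤k)
            L≤k = ℕ.m⊔n≤o⇒n≤o M L (ℕ.m⊔n≤o⇒n≤o N (M ℕ.⊔ L) ≤k)
        in <-by _ (0<+ (0<diff (gap k N≤k)) (0<+ (0<+ (0<diff (lower k M≤k)) 0<μ) (0<+ (0<diff (upper k L≤k)) 0<ν)))
          (solve 8 (λ c e μ ν xi xj yi yj →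
              c :+ con ½ :* e :+ (xj :- xi :- (c :+ e)
                :+ ((yj :- xj :- (:- (con ½ :* (con ½ :* e)) :+ μ)) :+ μ
                  :+ ((con ½ :* (con ½ :* e) :- (yi :- xi :+ ν)) :+ ν)))
              := yj :- yi)
            refl c ε μ ν (seq (x i) k) (seq (x j) k) (seq (y i) k) (seq (y j) k))

  half-intro : (q : Fin n → ℚ) → c ℚ.< q j ℚ.- q i → Half c j i (fromℚ ∘ q)
  half-intro q c< = ½ ℚ.* (q j ℚ.- q i ℚ.- c) , 0<half (0<diff c<) , 0 , λ _ _ →
    <-by _ (0<half (0<diff c<))
      (solve 2 (λ c d → c :+ con ½ :* (d :- c) :+ con ½ :* (d :- c) := d) refl c (q j ℚ.- q i))

  half-elim : (x : Point n) → Half c j i x → ∃[ N ] ∀ k → N ℕ.≤ k → c ℚ.< seq (x j) k ℚ.- seq (x i) k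
  half-elim x (ε , 0<ε , N , gap) = N , λ k N≤k → ℚ.<-trans (<-by ε 0<ε refl) (gap k N≤k)

  half-convex : Convex (Half c j i)
  half-convex a b (ε , 0<ε , M , a-gap) (η , 0<η , N , b-gap) {t} 0≤t t≤1 x on =
    ½ ℚ.* δ , 0<half 0<δ , 0 , λ k _ → ℚ.<-≤-trans (<-by _ (0<half 0<δ)
      (solve 2 (λ c d → c :+ con ½ :* d :+ con ½ :* d := c :+ d) refl c δ))
      (subst₂ (λ u v → c ℚ.+ δ ℚ.≤ u ℚ.- v) (sym (on j k)) (sym (on i k))
        (≤-by _ (0≤+ (0≤* (0≤diff (t≤1 k)) (0≤diff a≥)) (0≤* (0≤t k) (0≤diff b≥)))
          (solve 6 (λ e t aj ai bj bi →
              e :+ ((con 1ℚ :- t) :* (aj :- ai :- e) :+ t :* (bj :- bi :- e))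
              := aj :+ t :* (bj :- aj) :- (ai :+ t :* (bi :- ai)))
            refl (c ℚ.+ δ) (t k) (a j) (a i) (b j) (b i))))
    where
    δ = ε ℚ.⊓ η
    0<δ : 0ℚ ℚ.< δ
    0<δ with ℚ.⊓-sel ε η
    ... | inj₁ eq = subst (0ℚ ℚ.<_) (sym eq) 0<ε
    ... | inj₂ eq = subst (0ℚ ℚ.<_) (sym eq) 0<η
    a≥ : c ℚ.+ δ ℚ.≤ a j ℚ.- a i
    a≥ = ℚ.≤-trans (ℚ.+-monoʳ-≤ c (ℚ.p⊓q≤p ε η)) (ℚ.<⇒≤ (a-gap M ℕ.≤-refl))
    b≥ : c ℚ.+ δ ℚ.≤ b j ℚ.- b i
    b≥ = ℚ.≤-trans (ℚ.+-monoʳ-≤ c (ℚ.p⊓q≤q ε η)) (ℚ.<⇒≤ (b-gap N ℕ.≤-refl))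

module _ (c : ℚ) (j i : Fin n) (x : Point n) where

  half⇒reverse : Half (ℚ.- c) i j x → x j - x i < fromℚ c
  half⇒reverse (ε , 0<ε , N , gap) = ε , 0<ε , N , λ k N≤k → <-by _ (0<diff (gap k N≤k))
    (solve 4 (λ c e xi xj → xj :- xi :+ e :+ (xi :- xj :- (:- c :+ e)) := c) refl c ε (seq (x i) k) (seq (x j) k))

  reverse⇒half : x j - x i < fromℚ c → Half (ℚ.- c) i j x
  reverse⇒half (ε , 0<ε , N , gap) = ε , 0<ε , N , λ k N≤k → <-by _ (0<diff (gap k N≤k))
    (solve 4 (λ c e xi xj → :- c :+ e :+ (c :- (xj :- xi :+ e)) := xi :- xj) refl c ε (seq (x i) k) (seq (x j) k))

  half-disjoint : Half c j i x → ¬ Half (ℚ.- c) i j x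
  half-disjoint above below =
    let M , above = half-elim c j i x above
        N , below = half-elim (ℚ.- c) i j x below
        k = M ℕ.⊔ N
    in ℚ.<-irrefl
      (solve 3 (λ c xi xj → c :+ :- c := xj :- xi :+ (xi :- xj)) refl c (seq (x i) k) (seq (x j) k))
      (ℚ.+-mono-< (above k (ℕ.m≤m⊔n M N)) (below k (ℕ.m≤n⊔m M N)))

Side : Bool → ℕ → Fin n → Fin n → Pred (Point n) 0ℓ
Side true  t j i = Half (ι t) j i
Side false t j i = Half (ℚ.- ι t) i j

Cell : (Fin n → Fin n → Bool) → Pred (Point n) 0ℓ
Cell D x = ∀ j i → Side (D j i) (θ j i) j i x

side-open : ∀ b t (j i : Fin n) → IsOpen (Side b t j i)
side-open true  t j i = half-open (ι t) j i
side-open false t j i = half-open (ℚ.- ι t) i j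

side-convex : ∀ b t (j i : Fin n) → Convex (Side b t j i)
side-convex true  t j i = half-convex (ι t) j i
side-convex false t j i = half-convex (ℚ.- ι t) i j

side-unique : ∀ {b b′} t (j i : Fin n) (x : Point n) → Side b t j i x → Side b′ t j i x → b ≡ b′
side-unique {b = true}  {true}  t j i x _ _ = refl
side-unique {b = false} {false} t j i x _ _ = refl
side-unique {b = true}  {false} t j i x above below = contradiction below (half-disjoint (ι t) j i x above)
side-unique {b = false} {true}  t j i x below above = contradiction below (half-disjoint (ι t) j i x above)

cell-open : (D : Fin n → Fin n → Bool) → IsOpen (Cell D)
cell-open D = open-⋂ λ j → open-⋂ λ i → side-open (D j i) (θ j i) j i

cell-convex : (D : Fin n → Fin n → Bool) → Convex (Cell D)
cell-convex D a b Da Db 0≤t t≤1 x on j i =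
  side-convex (D j i) (θ j i) j i a b (Da j i) (Db j i) 0≤t t≤1 x on

cell-resp : (D D′ : Fin n → Fin n → Bool) → (∀ j i → D j i ≡ D′ j i) → Cell D ⊆ Cell D′
cell-resp D D′ D≗D′ {x} Dx j i = subst (λ b → Side b (θ j i) j i x) (D≗D′ j i) (Dx j i)

cell-unique : (D D′ : Fin n → Fin n → Bool) (x : Point n) → Cell D x → Cell D′ x → ∀ j i → D j i ≡ D′ j i
cell-unique D D′ x Dx D′x j i = side-unique (θ j i) j i x (Dx j i) (D′x j i)

shi⇒side : (x : Point n) → ShiComplement x → ∀ j i → ∃[ b ] Side b (θ j i) j i x
shi⇒side x shi j i with Fin.<-cmp j i
... | tri< j<i _ _ = subst (λ t → ∃[ b ] Side b t j i x) (sym (θ≡1 (ℕ.<⇒≤ j<i)))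
  ([ (λ below → false , reverse⇒half 1ℚ j i x below) , (λ above → true , above) ]′ (proj₂ (shi j i j<i)))
... | tri> _ _ i<j = subst (λ t → ∃[ b ] Side b t j i x) (sym (θ≡0 i<j))
  ([ (λ below → true , reverse⇒half 0ℚ i j x below) , (λ above → false , above) ]′ (proj₁ (shi i j i<j)))
-- The diagonal pair is no hyperplane: as x j - x j < 1 always, every point is on its `false` side,
-- with ½ as a gap.
... | tri≈ _ refl _ = subst (λ t → ∃[ b ] Side b t j j x) (sym (θ≡1 {j = j} ℕ.≤-refl))
  (false , ½ , ℚ.positive⁻¹ ½ , 0 , λ k _ →
    subst (ℚ.- 1ℚ ℚ.+ ½ ℚ.<_) (sym (ℚ.+-inverseʳ (seq (x j) k))) (from-yes (ℚ.- 1ℚ ℚ.+ ½ ℚ.<? 0ℚ)))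

shi⇒cell : (x : Point n) → ShiComplement x → ∃[ D ] Cell D x
shi⇒cell x shi = (λ j i → proj₁ (shi⇒side x shi j i)) , λ j i → proj₂ (shi⇒side x shi j i)

cell⇒shi : (D : Fin n → Fin n → Bool) → Cell D ⊆ ShiComplement
cell⇒shi D {x} Dx i j i<j =
    zero-side (D j i) (subst (λ t → Side (D j i) t j i x) (θ≡0 i<j) (Dx j i))
  , one-side (D i j) (subst (λ t → Side (D i j) t i j x) (θ≡1 (ℕ.<⇒≤ i<j)) (Dx i j))
  where
  zero-side : ∀ b → Side b 0 j i x → x i - x j # 0ℝ
  zero-side true  above = inj₁ (half⇒reverse 0ℚ i j x above)
  zero-side false below = inj₂ below
  one-side : ∀ b → Side b 1 i j x → x i - x j # 1ℝ
  one-side true  above = inj₂ above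
  one-side false below = inj₁ (half⇒reverse 1ℚ i j x below)

-- The cells with a sign different from D have an open union disjoint from `Cell D`, and sign
-- matrices can be compared; so these two sets would separate C.
connected-in-cell : {C : Pred (Point n) 0ℓ} → Connected C → C ⊆ ShiComplement →
  (D : Fin n → Fin n → Bool) → ∃ (C ∩ Cell D) → C ⊆ Cell D
connected-in-cell {n} {C} connected C⊆shi D meets {y} Cy =
  [ id , (λ other → contradiction (meets , y , Cy , other) separated) ]′ (cover y Cy)
  where
  Other : Pred (Point n) 0ℓ
  Other z = ∃[ D′ ] (Cell D′ z × ∃[ j ] ∃[ i ] (D j i ≢ D′ j i))
  Other-open : IsOpen Other
  Other-open z (D′ , D′z , differ) =
    let ε , 0<ε , ball⊆ = cell-open D′ z D′z
    in ε , 0<ε , λ {w} near → D′ , ball⊆ {w} near , differ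
  cover : ∀ z → C z → Cell D z ⊎ Other z
  cover z Cz with shi⇒cell z (C⊆shi Cz)
  ... | D′ , D′z with Fin.any? (λ j → Fin.any? λ i → ¬? (D j i Bool.≟ D′ j i))
  ...   | yes differ = inj₂ (D′ , D′z , differ)
  ...   | no same = inj₁ (cell-resp D′ D (λ j i → sym (decidable-stable (D j i Bool.≟ D′ j i)
            λ ≢ → same (j , i , ≢))) {z} D′z)
  separated : ¬ ((∃[ x ] (C x × Cell D x)) × (∃[ x ] (C x × Other x)))
  separated = connected (Cell D) Other (cell-open D) Other-open cover
    λ z _ (Dz , D′ , D′z , j , i , ≢) → ≢ (cell-unique D D′ z Dz D′z j i)

cell-component : (D : Fin n → Fin n → Bool) → ∃ (Cell D) → IsComponentOf ShiComplement (Cell D)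
cell-component D inhabited@(x , Dx) = record
  { inhabited = inhabited
  ; within = λ {y} → cell⇒shi D {y}
  ; connected = convex⇒connected (cell-open D) (cell-convex D)
  ; maximal = λ E E⊆shi connected D⊆E → connected-in-cell connected E⊆shi D (x , D⊆E Dx , Dx) }

-- Connectedness confines C to the cell of one of its points; maximality against that connected cell
-- makes C fill it.
component-cell : {C : Pred (Point n) 0ℓ} → IsComponentOf ShiComplement C → ∃[ D ] C ≐ Cell D
component-cell component =
  let x , Cx = inhabited
      D , Dx = shi⇒cell x (within Cx)
      C⊆D = λ {y} → connected-in-cell connected within D (x , Cx , Dx) {y}
  in D , C⊆D , maximal (Cell D) (λ {y} → cell⇒shi D {y}) (convex⇒connected (cell-open D) (cell-convex D)) C⊆D
  where open IsComponentOf component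

signs : (Fin n → ℚ) → Fin n → Fin n → Bool
signs q j i = does (q ⊢ j ▷? i)

▷⇒half : (q : Fin n → ℚ) {j i : Fin n} → q ⊢ j ▷ i → Half (ι (θ j i)) j i (fromℚ ∘ q)
▷⇒half q {j} {i} lt = half-intro (ι (θ j i)) j i q (<-by _ (0<diff lt)
  (solve 3 (λ qi qj t → t :+ (qj :- (qi :+ t)) := qj :- qi) refl (q i) (q j) (ι (θ j i))))

half⇒▷ : (q : Fin n → ℚ) {j i : Fin n} → Half (ι (θ j i)) j i (fromℚ ∘ q) → q ⊢ j ▷ i
half⇒▷ q {j} {i} half = let N , gap = half-elim (ι (θ j i)) j i (fromℚ ∘ q) half in
  <-by _ (0<diff (gap N ℕ.≤-refl))
    (solve 3 (λ qi qj t → qi :+ t :+ (qj :- qi :- t) := qj) refl (q i) (q j) (ι (θ j i)))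

half⇒<▷ : (q : Fin n → ℚ) {j i : Fin n} → Half (ℚ.- ι (θ j i)) i j (fromℚ ∘ q) → q j ℚ.< q i ℚ.+ ι (θ j i)
half⇒<▷ q {j} {i} half = let N , gap = half-elim (ℚ.- ι (θ j i)) i j (fromℚ ∘ q) half in
  <-by _ (0<diff (gap N ℕ.≤-refl))
    (solve 3 (λ qi qj t → qj :+ (qi :- qj :- (:- t)) := qi :+ t) refl (q i) (q j) (ι (θ j i)))

chamber : (Fin n → ℚ) → Pred (Point n) 0ℓ
chamber q = Cell (signs q)

generic⇒chamber : {q : Fin n → ℚ} → Generic q → chamber q (fromℚ ∘ q)
generic⇒chamber {q = q} generic j i = go (q ⊢ j ▷? i)
  where
  go : (d : Dec (q ⊢ j ▷ i)) → Side (does d) (θ j i) j i (fromℚ ∘ q)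
  go (yes j▷i) = ▷⇒half q j▷i
  go (no ¬j▷i) = half-intro (ℚ.- ι (θ j i)) i j q (<-by _
    (0<diff (ℚ.≰⇒> λ ≤qj → generic j i (ℚ.≤-antisym (ℚ.≮⇒≥ ¬j▷i) ≤qj)))
    (solve 3 (λ qi qj t → :- t :+ (qi :+ t :- qj) := qi :- qj) refl (q i) (q j) (ι (θ j i))))

cell⇒generic : (D : Fin n → Fin n → Bool) {q : Fin n → ℚ} → Cell D (fromℚ ∘ q) →
  Generic q × (∀ j i → D j i ≡ signs q j i)
cell⇒generic D {q} Dq = (λ j i → proj₁ (go (D j i) (Dq j i))) , λ j i → proj₂ (go (D j i) (Dq j i))
  where
  go : ∀ {j i} b → Side b (θ j i) j i (fromℚ ∘ q) → (q j ≢ q i ℚ.+ ι (θ j i)) × b ≡ signs q j i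
  go {j} {i} true above = (λ eq → ℚ.<-irrefl (sym eq) (half⇒▷ q above))
    , sym (dec-true (q ⊢ j ▷? i) (half⇒▷ q above))
  go {j} {i} false below = (λ eq → ℚ.<-irrefl eq (half⇒<▷ q below))
    , sym (dec-false (q ⊢ j ▷? i) (ℚ.<-asym (half⇒<▷ q below)))

component-chamber : {C : Pred (Point n) 0ℓ} → IsComponentOf ShiComplement C →
  ∃[ q ] (Generic q × C ≐ chamber q)
component-chamber component =
  let D , C⊆D , D⊆C = component-cell component
      x , Cx = IsComponentOf.inhabited component
      q , Dq = rational-point (cell-open D) (x , C⊆D Cx)
      generic , D≗ = cell⇒generic D {q} Dq
  in q , generic
   , (λ {y} Cy → cell-resp D (signs q) D≗ {y} (C⊆D Cy))
   , λ {y} qy → D⊆C (cell-resp (signs q) D (λ j i → sym (D≗ j i)) {y} qy)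

chamber-▷ : (q r : Fin n → ℚ) (x : Point n) → chamber q x → chamber r x → ∀ {j i} → q ⊢ j ▷ i → r ⊢ j ▷ i
chamber-▷ q r x qx rx {j} {i} j▷i = decidable-stable (r ⊢ j ▷? i) λ ¬j▷i →
  contradiction (trans (sym (dec-true (q ⊢ j ▷? i) j▷i))
    (trans (cell-unique (signs q) (signs r) x qx rx j i) (dec-false (r ⊢ j ▷? i) ¬j▷i))) λ ()

chamber-⊆ : (q r : Fin n → ℚ) → (∀ j i → q ⊢ j ▷ i → r ⊢ j ▷ i) → (∀ j i → r ⊢ j ▷ i → q ⊢ j ▷ i) →
  chamber q ⊆ chamber r
chamber-⊆ q r q⇒r r⇒q {x} = cell-resp (signs q) (signs r) (λ j i → same j i (q ⊢ j ▷? i)) {x}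
  where
  same : ∀ j i → Dec (q ⊢ j ▷ i) → signs q j i ≡ signs r j i
  same j i (yes j▷i) = trans (dec-true (q ⊢ j ▷? i) j▷i) (sym (dec-true (r ⊢ j ▷? i) (q⇒r j i j▷i)))
  same j i (no ¬j▷i) = trans (dec-false (q ⊢ j ▷? i) ¬j▷i) (sym (dec-false (r ⊢ j ▷? i) (¬j▷i ∘ r⇒q j i)))

-- The two partitions

PF : ℕ → Set
PF n = Setoid.Carrier (ParkingFunctions n)

parking-∘ : (σ : Permutation′ n) (f : Fin n → Fin n) → IsParking f → IsParking (f ∘ (σ ⟨$⟩ʳ_))
parking-∘ σ f (π , mono , bound) = π ∘ₚ Perm.flip σ
  , (λ {i} {j} i≤j → subst₂ Fin._≤_ (back i) (back j) (mono i≤j))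
  , λ i → subst (λ v → toℕ v ℕ.< suc (toℕ i)) (back i) (bound i)
  where
  back : ∀ i → f (π ⟨$⟩ʳ i) ≡ f (σ ⟨$⟩ʳ (σ ⟨$⟩ˡ (π ⟨$⟩ʳ i)))
  back i = cong f (sym (inverseʳ σ))

module _ (x : Fin n → ℚ) where

  private
    label<n : ∀ j → label x j ℕ.< n
    label<n j = ∃¬⇒count<n (x ⊢ j ▷?_) (j , λ j▷j → ℚ.<-irrefl refl (▷⇒< x j▷j))

  labelFin : Fin n → Fin n
  labelFin j = fromℕ< (label<n j)

  toℕ-labelFin : ∀ j → toℕ (labelFin j) ≡ label x j
  toℕ-labelFin j = Fin.toℕ-fromℕ< (label<n j)

  label-parking : IsParking labelFin
  label-parking = below⇒parking (hall⇒below λ H? ∃H →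
    map₂ (λ {j} → map₂ (subst (ℕ._≤ _) (sym (toℕ-labelFin j)))) (label-hall x H? ∃H))

labelFin-cong : (x y : Fin n → ℚ) → label x ≗ label y → labelFin x ≗ labelFin y
labelFin-cong x y eq j =
  Fin.toℕ-injective (trans (toℕ-labelFin x j) (trans (eq j) (sym (toℕ-labelFin y j))))

labelFin-cancel : (x y : Fin n → ℚ) → labelFin x ≗ labelFin y → label x ≗ label y
labelFin-cancel x y eq j =
  trans (sym (toℕ-labelFin x j)) (trans (cong toℕ (eq j)) (toℕ-labelFin y j))

▷⇒label : (x y : Fin n → ℚ) → (∀ j i → x ⊢ j ▷ i → y ⊢ j ▷ i) → (∀ j i → y ⊢ j ▷ i → x ⊢ j ▷ i) →
  label x ≗ label y
▷⇒label x y x⇒y y⇒x j = count-cong (x ⊢ j ▷?_) (y ⊢ j ▷?_) (x⇒y j _) (y⇒x j _)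

module _ {x y : Fin n → ℚ} (x-generic : Generic x) (y-generic : Generic y) where

  label⇒chamber : label x ≗ label y → chamber x ≐ chamber y
  label⇒chamber same =
      (λ {z} → chamber-⊆ x y x⇒y y⇒x {z})
    , (λ {z} → chamber-⊆ y x y⇒x x⇒y {z})
    where
    x⇒y = label-injective x-generic y-generic same
    y⇒x = label-injective y-generic x-generic (sym ∘ same)

  chamber⇒label : chamber x ⊆ chamber y → label x ≗ label y
  chamber⇒label x⊆y = ▷⇒label x y
    (λ j i → chamber-▷ x y (fromℚ ∘ x) x∈ (x⊆y x∈) {j} {i})
    (λ j i → chamber-▷ y x (fromℚ ∘ x) (x⊆y x∈) x∈ {j} {i})
    where
    x∈ : chamber x (fromℚ ∘ x)
    x∈ = generic⇒chamber x-generic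

abstract

  configuration : (f : PF n) → ∃[ x ] (Generic x × label x ≗ toℕ ∘ proj₁ f)
  configuration (f , parking) = label-surjective (parking⇒hall parking)

config : PF n → Fin n → ℚ
config = proj₁ ∘ configuration

config-generic : (f : PF n) → Generic (config f)
config-generic f = proj₁ (proj₂ (configuration f))

label-config : (f : PF n) → label (config f) ≗ toℕ ∘ proj₁ f
label-config f = proj₂ (proj₂ (configuration f))

config-label : (x : Fin n → ℚ) → label (config (labelFin x , label-parking x)) ≗ label x
config-label x j = trans (label-config (labelFin x , label-parking x) j) (toℕ-labelFin x j)

labelFin-config : (f : PF n) → labelFin (config f) ≗ proj₁ f
labelFin-config f j = Fin.toℕ-injective (trans (toℕ-labelFin (config f) j) (label-config f j))

abstract

  region-point : (R : Setoid.Carrier (Regions n)) → ∃[ q ] (Generic q × proj₁ R ≐ chamber q)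
  region-point (C , component) = component-chamber component

-- Directed from functions to regions, through a chosen point with the given label. All four laws
-- reduce to one fact: generic points have equal labels exactly when their chambers coincide.
pakStanley : Inverse (ParkingFunctions n) (Regions n)
pakStanley {n} = mkInverse {S = ParkingFunctions n} {T = Regions n} to from to-cong from-cong to∘from from∘to
  where
  to : PF n → Setoid.Carrier (Regions n)
  to f = chamber (config f)
       , cell-component (signs (config f)) (fromℚ ∘ config f , generic⇒chamber (config-generic f))
  from : Setoid.Carrier (Regions n) → PF n
  from R = labelFin (proj₁ (region-point R)) , label-parking (proj₁ (region-point R))
  to-cong : ∀ {f g : PF n} → proj₁ f ≗ proj₁ g → chamber (config f) ≐ chamber (config g)
  to-cong {f} {g} f≗g = label⇒chamber (config-generic f) (config-generic g)
    λ j → trans (label-config f j) (trans (cong toℕ (f≗g j)) (sym (label-config g j)))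
  from-cong : ∀ {R S} → proj₁ R ≐ proj₁ S → proj₁ (from R) ≗ proj₁ (from S)
  from-cong {R} {S} (R⊆S , _) =
    let q , q-generic , _ , q⊆R = region-point R
        r , r-generic , S⊆r , _ = region-point S
    in labelFin-cong q r (chamber⇒label q-generic r-generic λ {z} qz → S⊆r (R⊆S (q⊆R qz)))
  to∘from : ∀ R → chamber (config (from R)) ≐ proj₁ R
  to∘from R =
    let q , q-generic , R⊆q , q⊆R = region-point R
        c⊆q , q⊆c = label⇒chamber (config-generic (from R)) q-generic (config-label q)
    in (λ {z} cz → q⊆R (c⊆q {z} cz)) , λ {z} Rz → q⊆c {z} (R⊆q Rz)
  from∘to : ∀ f → proj₁ (from (to f)) ≗ proj₁ f
  from∘to f j =
    let q , q-generic , c⊆q , q⊆c = region-point (to f)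
    in trans (labelFin-cong q (config f) (chamber⇒label q-generic (config-generic f) λ {z} → q⊆c {z}) j) (labelFin-config f j)

-- A proof of `IsParking` contains a sorting permutation, which need not be unique, and `config`
-- takes that proof as input. A class defined through `config` must be shown independent of it
-- before it is counted.
Respected : Pred (PF n) 0ℓ → Set
Respected {n} Q = (f g : PF n) → proj₁ f ≗ proj₁ g → Q f → Q g

module Enumeration {Q : Pred (PF n) 0ℓ} (Q? : Decidable Q)
  (Q-resp : Respected Q) where

  Code : Pred (Fin n → Fin n) 0ℓ
  Code f = Σ[ p ∈ IsParking f ] Q (f , p)

  code? : Decidable Code
  code? f = decide (isParking? f)
    where
    decide : Dec (IsParking f) → Dec (Code f)
    decide (no ¬p) = no (¬p ∘ proj₁)
    decide (yes p) = map′ (p ,_) (λ (p′ , q) → Q-resp (f , p′) (f , p) (λ _ → refl) q) (Q? (f , p))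

  code-resp : ∀ {f g} → f ≗ g → Code f → Code g
  code-resp {f} {g} f≗g (p , q) = isParking-resp f≗g p , Q-resp (f , p) (g , isParking-resp f≗g p) f≗g q

  size : ℕ
  size = count (code? ∘ finToFun)

  hasSize : HasSize (ParkingFunctions n suchThat Q) size
  hasSize = Compose.inverse (functions-size code-resp code?)
    (mkInverse {S = (Fin n →-setoid Fin n) suchThat Code} {T = ParkingFunctions n suchThat Q}
      (λ (f , p , q) → (f , p) , q) (λ ((f , p) , q) → f , p , q)
      id id (λ _ _ → refl) (λ _ _ → refl))

open Enumeration using (size; hasSize)

module _ {Q R : Pred (PF n) 0ℓ}
  (Q? : Decidable Q) (Q-resp : Respected Q)
  (R? : Decidable R) (R-resp : Respected R) where

  size-injection : (g : ∀ f → Q f → PF n) → (∀ f q → R (g f q)) →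
    (∀ f f′ q q′ → proj₁ (g f q) ≗ proj₁ (g f′ q′) → proj₁ f ≗ proj₁ f′) →
    size Q? Q-resp ℕ.≤ size R? R-resp
  size-injection g Q⇒R injective = size-≤ (hasSize Q? Q-resp) (hasSize R? R-resp)
    (λ (f , q) → g f q , Q⇒R f q) (λ {(f , q)} {(f′ , q′)} → injective f f′ q q′)

  size-mono : (∀ f → Q f → R f) → size Q? Q-resp ℕ.≤ size R? R-resp
  size-mono Q⇒R = size-injection (λ f _ → f) Q⇒R (λ _ _ _ _ → id)

size-trichotomy : {A B C : Pred (PF n) 0ℓ}
  (A? : Decidable A) (A-resp : Respected A)
  (B? : Decidable B) (B-resp : Respected B)
  (C? : Decidable C) (C-resp : Respected C) →
  (∀ {f} → A f → ¬ B f) → (∀ {f} → A f → ¬ C f) → (∀ {f} → B f → ¬ C f) → (∀ f → A f ⊎ B f ⊎ C f) →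
  size A? A-resp ℕ.+ size B? B-resp ℕ.+ size C? C-resp ≡ count (isParking? ∘ finToFun {n} {n})
size-trichotomy A? A-resp B? B-resp C? C-resp ¬AB ¬AC ¬BC total =
  count-trichotomy (A.code? ∘ finToFun) (B.code? ∘ finToFun) (C.code? ∘ finToFun) (isParking? ∘ finToFun)
    (λ _ (_ , a) (_ , b) → ¬AB a (B-resp _ _ (λ _ → refl) b))
    (λ _ (_ , a) (_ , c) → ¬AC a (C-resp _ _ (λ _ → refl) c))
    (λ _ (_ , b) (_ , c) → ¬BC b (C-resp _ _ (λ _ → refl) c))
    [ proj₁ , [ proj₁ , proj₁ ]′ ]′
    (λ p → [ (λ a → inj₁ (p , a)) , [ (λ b → inj₂ (inj₁ (p , b))) , (λ c → inj₂ (inj₂ (p , c))) ]′ ]′ (total (_ , p)))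
  where
  module A = Enumeration A? A-resp
  module B = Enumeration B? B-resp
  module C = Enumeration C? C-resp

-- Rows and labels at the first two coordinates, and their exchange.

σ : Permutation′ (2 ℕ.+ m)
σ = Perm.swap Perm.id

exchange : Fin (2 ℕ.+ m) → Fin (2 ℕ.+ m)
exchange = σ ⟨$⟩ʳ_

module _ (x : Fin (2 ℕ.+ m) → ℚ) where

  1▷0⇒label< : x ⊢ 1F ▷ 0F → label x 0F ℕ.< label x 1F
  1▷0⇒label< 1▷0 = count-strict (x ⊢ 0F ▷?_) (x ⊢ 1F ▷?_)
    (λ {i} → ▷-mono x ℚ.≤-refl (θ-antitone i z≤n) (ℚ.<⇒≤ (▷⇒< x 1▷0)))
    {0F} 1▷0 (λ 0▷0 → ℚ.<-irrefl refl (▷⇒< x 0▷0))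

  ¬1▷0⇒≤ : ¬ x ⊢ 1F ▷ 0F → x 1F ℚ.≤ x 0F
  ¬1▷0⇒≤ ¬1▷0 = ℚ.≮⇒≥ λ x0<x1 → ¬1▷0 (<⇒▷ x (s≤s z≤n) x0<x1)

  row-⊇ : x 1F ℚ.≤ x 0F → ∀ {i} → x ⊢ 1F ▷ i → x ⊢ 0F ▷ i
  row-⊇ x1≤x0 {0F}    1▷0 = contradiction x1≤x0 (<⇒≱ (▷⇒< x 1▷0))
  -- Past `0F` the thresholds of the first two rows are both 1.
  row-⊇ x1≤x0 {suc i} 1▷i = ▷-mono x ℚ.≤-refl ℕ.≤-refl x1≤x0 1▷i

  ¬1▷0⇒label≥ : ¬ x ⊢ 1F ▷ 0F → label x 1F ℕ.≤ label x 0F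
  ¬1▷0⇒label≥ ¬1▷0 = count-mono (x ⊢ 1F ▷?_) (x ⊢ 0F ▷?_) (row-⊇ (¬1▷0⇒≤ ¬1▷0))

  0▷1⇒label> : x ⊢ 0F ▷ 1F → label x 1F ℕ.< label x 0F
  0▷1⇒label> 0▷1 = count-strict (x ⊢ 1F ▷?_) (x ⊢ 0F ▷?_) (row-⊇ (ℚ.<⇒≤ (▷⇒< x 0▷1)))
    {1F} 0▷1 (λ 1▷1 → ℚ.<-irrefl refl (▷⇒< x 1▷1))

  -- The exchanged point would be on x₁ - x₂ = 1 only if `x 1F` were `x 0F + 1`, which x₂ < x₁
  -- forbids. All other hyperplanes are permuted, because `0F` and `1F` have the same thresholds
  -- against every later index.
  exchange-generic : Generic x → ¬ x ⊢ 1F ▷ 0F → Generic (x ∘ exchange)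
  exchange-generic generic ¬1▷0 0F 1F eq = <⇒≱ (ℚ.<-≤-trans
    (subst (ℚ._< x 0F ℚ.+ 1ℚ) (ℚ.+-identityʳ (x 0F)) (ℚ.+-monoʳ-< (x 0F) (ℚ.positive⁻¹ 1ℚ)))
    (ℚ.≤-reflexive (sym eq))) (¬1▷0⇒≤ ¬1▷0)
  exchange-generic generic ¬1▷0 1F 0F eq with generic-injective x generic {0F} {1F} (trans eq (ℚ.+-identityʳ (x 1F)))
  ... | ()
  exchange-generic generic _ 0F            0F            = generic 1F 1F
  exchange-generic generic _ 1F            1F            = generic 0F 0F
  exchange-generic generic _ 0F            (suc (suc i)) = generic 1F (suc (suc i))
  exchange-generic generic _ 1F            (suc (suc i)) = generic 0F (suc (suc i))
  exchange-generic generic _ (suc (suc j)) 0F            = generic (suc (suc j)) 1F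
  exchange-generic generic _ (suc (suc j)) 1F            = generic (suc (suc j)) 0F
  exchange-generic generic _ (suc (suc j)) (suc (suc i)) = generic (suc (suc j)) (suc (suc i))

  exchange-1▷0 : Generic x → ¬ x ⊢ 1F ▷ 0F → (x ∘ exchange) ⊢ 1F ▷ 0F
  exchange-1▷0 generic ¬1▷0 = <⇒▷ (x ∘ exchange) {1F} {0F} (s≤s z≤n) (≤∧≢⇒< x generic {1F} {0F} (λ ()) (¬1▷0⇒≤ ¬1▷0))

exchange-▷ : (x y : Fin (2 ℕ.+ m) → ℚ) → (x ⊢ 1F ▷ 0F → y ⊢ 1F ▷ 0F) → (x ⊢ 0F ▷ 1F → y ⊢ 0F ▷ 1F) →
  (∀ j i → (x ∘ exchange) ⊢ j ▷ i → (y ∘ exchange) ⊢ j ▷ i) → ∀ j i → x ⊢ j ▷ i → y ⊢ j ▷ i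
exchange-▷ x y 1▷0 0▷1 h 0F            1F            = 0▷1
exchange-▷ x y 1▷0 0▷1 h 1F            0F            = 1▷0
exchange-▷ x y 1▷0 0▷1 h 0F            0F            = h 1F 1F
exchange-▷ x y 1▷0 0▷1 h 1F            1F            = h 0F 0F
exchange-▷ x y 1▷0 0▷1 h 0F            (suc (suc i)) = h 1F (suc (suc i))
exchange-▷ x y 1▷0 0▷1 h 1F            (suc (suc i)) = h 0F (suc (suc i))
exchange-▷ x y 1▷0 0▷1 h (suc (suc j)) 0F            = h (suc (suc j)) 1F
exchange-▷ x y 1▷0 0▷1 h (suc (suc j)) 1F            = h (suc (suc j)) 0F
exchange-▷ x y 1▷0 0▷1 h (suc (suc j)) (suc (suc i)) = h (suc (suc j)) (suc (suc i))

module _ (m : ℕ) where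

  private
    N = 2 ℕ.+ m

  -- The last three are the classes of regions below 0, between 0 and 1, and above 1, read at the
  -- point chosen for the label.
  Gt Eq Lt Neg Mid Big : Pred (PF N) 0ℓ
  Gt = ParkGt m
  Eq = ParkEq m
  Lt = ParkLt m
  Neg f = config f ⊢ 1F ▷ 0F
  Mid f = ¬ config f ⊢ 1F ▷ 0F × ¬ config f ⊢ 0F ▷ 1F
  Big f = config f ⊢ 0F ▷ 1F

  gt? : Decidable Gt
  gt? (f , _) = f 1F Fin.<? f 0F
  eq? : Decidable Eq
  eq? (f , _) = f 0F Fin.≟ f 1F
  lt? : Decidable Lt
  lt? (f , _) = f 0F Fin.<? f 1F
  neg? : Decidable Neg
  neg? f = config f ⊢ 1F ▷? 0F
  big? : Decidable Big
  big? f = config f ⊢ 0F ▷? 1F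
  mid? : Decidable Mid
  mid? f = ¬? (neg? f) ×-dec ¬? (big? f)

  gt-resp : Respected Gt
  gt-resp _ _ f≗g = subst₂ Fin._<_ (f≗g 1F) (f≗g 0F)
  eq-resp : Respected Eq
  eq-resp _ _ f≗g = subst₂ _≡_ (f≗g 0F) (f≗g 1F)
  lt-resp : Respected Lt
  lt-resp _ _ f≗g = subst₂ Fin._<_ (f≗g 0F) (f≗g 1F)

  config-▷ : ∀ (f g : PF N) → proj₁ f ≗ proj₁ g → ∀ j i → config f ⊢ j ▷ i → config g ⊢ j ▷ i
  config-▷ f g f≗g = label-injective (config-generic f) (config-generic g)
    λ j → trans (label-config f j) (trans (cong toℕ (f≗g j)) (sym (label-config g j)))

  neg-resp : Respected Neg
  neg-resp f g f≗g = config-▷ f g f≗g 1F 0F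
  big-resp : Respected Big
  big-resp f g f≗g = config-▷ f g f≗g 0F 1F
  mid-resp : Respected Mid
  mid-resp f g f≗g (¬neg , ¬big) = ¬neg ∘ neg-resp g f (sym ∘ f≗g) , ¬big ∘ big-resp g f (sym ∘ f≗g)

  #gt = size gt? gt-resp
  #eq = size eq? eq-resp
  #lt = size lt? lt-resp
  #neg = size neg? neg-resp
  #mid = size mid? mid-resp
  #big = size big? big-resp

  neg⇒lt : ∀ f → Neg f → Lt f
  neg⇒lt f neg = subst₂ ℕ._<_ (label-config f 0F) (label-config f 1F) (1▷0⇒label< (config f) neg)

  ¬neg⇒≥ : ∀ f → ¬ Neg f → proj₁ f 1F Fin.≤ proj₁ f 0F
  ¬neg⇒≥ f ¬neg = subst₂ ℕ._≤_ (label-config f 1F) (label-config f 0F) (¬1▷0⇒label≥ (config f) ¬neg)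

  big⇒gt : ∀ f → Big f → Gt f
  big⇒gt f big = subst₂ ℕ._<_ (label-config f 1F) (label-config f 0F) (0▷1⇒label> (config f) big)

  lt⇒neg : ∀ f → Lt f → Neg f
  lt⇒neg f lt = decidable-stable (neg? f) λ ¬neg → ℕ.<⇒≱ lt (¬neg⇒≥ f ¬neg)

  eq⇒mid : ∀ f → Eq f → Mid f
  eq⇒mid f eq = (λ neg → ℕ.<⇒≢ (neg⇒lt f neg) (cong toℕ eq))
            , (λ big → ℕ.<⇒≢ (big⇒gt f big) (cong toℕ (sym eq)))

  #gt≡#lt : #gt ≡ #lt
  #gt≡#lt = ℕ.≤-antisym
    (size-injection gt? gt-resp lt? lt-resp (λ f _ → swap f) (λ _ → id) (λ f f′ _ _ → swap-injective f f′))
    (size-injection lt? lt-resp gt? gt-resp (λ f _ → swap f) (λ _ → id) (λ f f′ _ _ → swap-injective f f′))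
    where
    swap : PF N → PF N
    swap (f , p) = f ∘ exchange , parking-∘ σ f p
    swap-injective : ∀ (f f′ : PF N) → proj₁ (swap f) ≗ proj₁ (swap f′) → proj₁ f ≗ proj₁ f′
    swap-injective f f′ eq 0F            = eq 1F
    swap-injective f f′ eq 1F            = eq 0F
    swap-injective f f′ eq (suc (suc i)) = eq (suc (suc i))

  #neg≡#lt : #neg ≡ #lt
  #neg≡#lt = ℕ.≤-antisym
    (size-mono neg? neg-resp lt? lt-resp neg⇒lt)
    (size-mono lt? lt-resp neg? neg-resp lt⇒neg)

  #eq≤#mid : #eq ℕ.≤ #mid
  #eq≤#mid = size-mono eq? eq-resp mid? mid-resp eq⇒mid

  -- Exchanging the first two coordinates preserves every hyperplane but x₁ - x₂ = 1,
  -- and turns ¬ Neg into Neg.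
  size≤#neg : {Q : Pred (PF N) 0ℓ} (Q? : Decidable Q) (Q-resp : Respected Q) →
    (∀ f → Q f → ¬ Neg f) → (∀ f g → Q f → Q g → Big f → Big g) → size Q? Q-resp ℕ.≤ #neg
  size≤#neg {Q} Q? Q-resp ¬neg big = size-injection Q? Q-resp neg? neg-resp (λ f _ → reflect f) reflect-neg
    λ f g q q′ eq j → Fin.toℕ-injective
      (trans (sym (label-config f j)) (trans (same-label f g q q′ eq j) (label-config g j)))
    where
    x : PF N → Fin N → ℚ
    x f = config f ∘ exchange
    x-generic : ∀ f → Q f → Generic (x f)
    x-generic f q = exchange-generic (config f) (config-generic f) (¬neg f q)
    reflect : PF N → PF N
    reflect f = labelFin (x f) , label-parking (x f)
    reflect-neg : ∀ f → Q f → Neg (reflect f)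
    reflect-neg f q = label-injective (x-generic f q) (config-generic (reflect f))
      (sym ∘ config-label (x f)) 1F 0F (exchange-1▷0 (config f) (config-generic f) (¬neg f q))
    back : ∀ f g → Q f → Q g → label (x f) ≗ label (x g) → ∀ j i → config f ⊢ j ▷ i → config g ⊢ j ▷ i
    back f g q q′ same = exchange-▷ (config f) (config g)
      (λ neg → contradiction neg (¬neg f q)) (big f g q q′)
      (label-injective (x-generic f q) (x-generic g q′) same)

    same-label : ∀ f g → Q f → Q g → labelFin (x f) ≗ labelFin (x g) → label (config f) ≗ label (config g)
    same-label f g q q′ eq = ▷⇒label (config f) (config g)
      (back f g q q′ (labelFin-cancel (x f) (x g) eq)) (back g f q′ q (sym ∘ labelFin-cancel (x f) (x g) eq))

  -- The exchange forgets only the side of x₁ - x₂ = 1, and `Mid` fixes that side by excluding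
  -- `Big`.
  #mid≤#neg : #mid ℕ.≤ #neg
  #mid≤#neg = size≤#neg mid? mid-resp (λ _ → proj₁)
    (λ _ _ (_ , ¬big) _ big → contradiction big ¬big)

  big⇒¬neg : ∀ f → Big f → ¬ Neg f
  big⇒¬neg f big neg = ℚ.<-asym (▷⇒< (config f) big) (▷⇒< (config f) neg)

  #big≤#neg : #big ℕ.≤ #neg
  #big≤#neg = size≤#neg big? big-resp big⇒¬neg (λ _ _ _ big _ → big)

  sums≡ : #gt ℕ.+ #eq ℕ.+ #lt ≡ #neg ℕ.+ #mid ℕ.+ #big
  sums≡ = trans
    (size-trichotomy gt? gt-resp eq? eq-resp lt? lt-resp
      (λ gt eq → ℕ.<⇒≢ gt (cong toℕ (sym eq))) ℕ.<-asym (λ eq lt → ℕ.<⇒≢ lt (cong toℕ eq)) compare)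
    (sym (size-trichotomy neg? neg-resp mid? mid-resp
      big? big-resp
      (λ neg (¬neg , _) → ¬neg neg) (λ {f} neg big → big⇒¬neg f big neg) (λ (_ , ¬big) → ¬big) locate))
    where
    compare : ∀ f → Gt f ⊎ Eq f ⊎ Lt f
    compare (f , _) with Fin.<-cmp (f 0F) (f 1F)
    ... | tri< lt _ _ = inj₂ (inj₂ lt)
    ... | tri≈ _ eq _ = inj₂ (inj₁ eq)
    ... | tri> _ _ gt = inj₁ gt
    locate : ∀ f → Neg f ⊎ Mid f ⊎ Big f
    locate f with neg? f | big? f
    ... | yes neg | _       = inj₁ neg
    ... | no _    | yes big = inj₂ (inj₂ big)
    ... | no ¬neg | no ¬big = inj₂ (inj₁ (¬neg , ¬big))

  module _ {C : Pred (Point N) 0ℓ} {q : Fin N → ℚ} (generic : Generic q) (C≐q : C ≐ chamber q) where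

    private
      q∈C : C (fromℚ ∘ q)
      q∈C = proj₂ C≐q (generic⇒chamber generic)

      side : ∀ {b} j i → signs q j i ≡ b → ∀ {x} → C x → Side b (θ j i) j i x
      side j i eq {x} Cx = subst (λ b → Side b (θ j i) j i x) eq (proj₁ C≐q Cx j i)

      above : ∀ {j i} → q ⊢ j ▷ i → ∀ {x} → C x → Side true (θ j i) j i x
      above {j} {i} j▷i = side j i (dec-true (q ⊢ j ▷? i) j▷i)

      below : ∀ {j i} → ¬ q ⊢ j ▷ i → ∀ {x} → C x → Side false (θ j i) j i x
      below {j} {i} ¬j▷i = side j i (dec-false (q ⊢ j ▷? i) ¬j▷i)

    below0-intro : q ⊢ 1F ▷ 0F → ∀ x → C x → x 0F - x 1F < 0ℝ
    below0-intro 1▷0 x Cx = half⇒reverse 0ℚ 0F 1F x (above 1▷0 Cx)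

    -- The rational representative belongs to C, so the hypothesis need only be read there.
    below0-elim : (∀ x → C x → x 0F - x 1F < 0ℝ) → q ⊢ 1F ▷ 0F
    below0-elim h = half⇒▷ q (reverse⇒half 0ℚ 0F 1F (fromℚ ∘ q) (h (fromℚ ∘ q) q∈C))

    above1-intro : q ⊢ 0F ▷ 1F → ∀ x → C x → x 0F - x 1F > 1ℝ
    above1-intro 0▷1 x Cx = above 0▷1 Cx

    above1-elim : (∀ x → C x → x 0F - x 1F > 1ℝ) → q ⊢ 0F ▷ 1F
    above1-elim h = half⇒▷ q (h (fromℚ ∘ q) q∈C)

    between-intro : ¬ q ⊢ 1F ▷ 0F × ¬ q ⊢ 0F ▷ 1F → ∀ x → C x → (0ℝ < x 0F - x 1F) × (x 0F - x 1F < 1ℝ)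
    between-intro (¬1▷0 , ¬0▷1) x Cx = below ¬1▷0 Cx , half⇒reverse 1ℚ 0F 1F x (below ¬0▷1 Cx)

    between-elim : (∀ x → C x → (0ℝ < x 0F - x 1F) × (x 0F - x 1F < 1ℝ)) → ¬ q ⊢ 1F ▷ 0F × ¬ q ⊢ 0F ▷ 1F
    between-elim h =
        (λ 1▷0 → half-disjoint 0ℚ 1F 0F (fromℚ ∘ q) (▷⇒half q 1▷0) (proj₁ (h (fromℚ ∘ q) q∈C)))
      , (λ 0▷1 → half-disjoint 1ℚ 0F 1F (fromℚ ∘ q) (▷⇒half q 0▷1)
          (reverse⇒half 1ℚ 0F 1F (fromℚ ∘ q) (proj₂ (h (fromℚ ∘ q) q∈C))))

  private
    Region = Setoid.Carrier (Regions N)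
    module PS = Inverse (pakStanley {N})

    ≐-refl : {C : Pred (Point N) 0ℓ} → C ≐ C
    ≐-refl = id , id

    region-≐ : ∀ (R : Region) → proj₁ R ≐ chamber (config (PS.from R))
    region-≐ R = let c⊆ , ⊆c = PS.strictlyInverseˡ R in (λ {x} → ⊆c {x}) , (λ {x} → c⊆ {x})

  parkingPartition : IsParkingPartition m ⟨ #gt , #eq , #lt ⟩
  parkingPartition = record { gt = hasSize gt? gt-resp ; eq = hasSize eq? eq-resp ; lt = hasSize lt? lt-resp }

  treePosetPartition : IsTreePosetPartition m ⟨ #neg , #mid , #big ⟩
  treePosetPartition = record
    { below0 = Compose.inverse (hasSize neg? neg-resp) (restrict pakStanley
        (λ f → below0-intro (config-generic f) ≐-refl)
        (λ R → below0-elim (config-generic (PS.from R)) (region-≐ R)))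
    ; between01 = Compose.inverse (hasSize mid? mid-resp) (restrict pakStanley
        (λ f → between-intro (config-generic f) ≐-refl)
        (λ R → between-elim (config-generic (PS.from R)) (region-≐ R)))
    ; above1 = Compose.inverse (hasSize big? big-resp) (restrict pakStanley
        (λ f → above1-intro (config-generic f) ≐-refl)
        (λ R → above1-elim (config-generic (PS.from R)) (region-≐ R)))
    }

-- Majorisation of the sorted triples.

module _ {a e c d : ℕ} (c≤a : c ℕ.≤ a) (d≤a : d ℕ.≤ a) (sum-eq : a ℕ.+ e ℕ.+ a ≡ a ℕ.+ c ℕ.+ d) where

  private
    sorted-max : ∀ {s t v} → s SortedFormOf t → v ∈ₗ toList t → v ℕ.≤ Triple.part₁ s
    sorted-max (s₁≥s₂ , s₂≥s₃ , s↭t) v∈t with ∈-resp-↭ (↭-sym s↭t) v∈t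
    ... | here refl                 = ℕ.≤-refl
    ... | there (here refl)         = s₁≥s₂
    ... | there (there (here refl)) = ℕ.≤-trans s₂≥s₃ s₁≥s₂

    sorted-min : ∀ {s t v} → s SortedFormOf t → v ∈ₗ toList t → Triple.part₃ s ℕ.≤ v
    sorted-min (s₁≥s₂ , s₂≥s₃ , s↭t) v∈t with ∈-resp-↭ (↭-sym s↭t) v∈t
    ... | here refl                 = ℕ.≤-trans s₂≥s₃ s₁≥s₂
    ... | there (here refl)         = s₂≥s₃
    ... | there (there (here refl)) = ℕ.≤-refl

    total : Triple → ℕ
    total ⟨ x , y , z ⟩ = x ℕ.+ y ℕ.+ z

    total≡sum : ∀ t → total t ≡ List.sum (toList t)
    total≡sum ⟨ x , y , z ⟩ = trans (ℕ.+-assoc x y z) (cong (λ w → x ℕ.+ (y ℕ.+ w)) (sym (ℕ.+-identityʳ z)))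

    sorted-total : ∀ {s t} → s SortedFormOf t → total s ≡ total t
    sorted-total {s} {t} (_ , _ , s↭t) = trans (total≡sum s) (trans (List.sum-↭ s↭t) (sym (total≡sum t)))

  -- The least part of s is at most e, so its two largest parts sum to at least 2a, while every part
  -- of t is at most a.
  majorises : ∀ s t → s SortedFormOf ⟨ a , e , a ⟩ → t SortedFormOf ⟨ a , c , d ⟩ → s Majorises t
  majorises s@(⟨ s₁ , s₂ , s₃ ⟩) t@(⟨ t₁ , t₂ , t₃ ⟩) sorted-s sorted-t@(t₁≥t₂ , _ , t↭) =
      ℕ.≤-trans t₁≤a (sorted-max {s} {⟨ a , e , a ⟩} sorted-s (here refl))
    , ℕ.+-cancelʳ-≤ e (t₁ ℕ.+ t₂) (s₁ ℕ.+ s₂) (begin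
        t₁ ℕ.+ t₂ ℕ.+ e   ≤⟨ ℕ.+-monoˡ-≤ e (ℕ.+-mono-≤ t₁≤a (ℕ.≤-trans t₁≥t₂ t₁≤a)) ⟩
        a ℕ.+ a ℕ.+ e     ≡⟨ ℕ.+-assoc a a e ⟩
        a ℕ.+ (a ℕ.+ e)   ≡⟨ ℕ.+-comm a (a ℕ.+ e) ⟩
        a ℕ.+ e ℕ.+ a     ≡⟨ sorted-total {s} sorted-s ⟨
        s₁ ℕ.+ s₂ ℕ.+ s₃  ≤⟨ ℕ.+-monoʳ-≤ (s₁ ℕ.+ s₂) (sorted-min {s} {⟨ a , e , a ⟩} sorted-s (there (here refl))) ⟩
        s₁ ℕ.+ s₂ ℕ.+ e   ∎)
    , trans (sorted-total {s} sorted-s) (trans sum-eq (sym (sorted-total {t} sorted-t)))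
    where
    open ℕ.≤-Reasoning
    t₁≤a : t₁ ℕ.≤ a
    t₁≤a with ∈-resp-↭ t↭ (here refl)
    ... | here refl                 = ℕ.≤-refl
    ... | there (here refl)         = c≤a
    ... | there (there (here refl)) = d≤a

theorem3 : (m : ℕ) →
    ∃[ park ] ∃[ tree ]
    ( IsParkingPartition m park
    × IsTreePosetPartition m tree
    × largest park ≡ largest tree
    × ((s t : Triple) → s SortedFormOf park → t SortedFormOf tree → s Majorises t) )
theorem3 m = ⟨ #gt m , #eq m , #lt m ⟩ , ⟨ #neg m , #mid m , #big m ⟩
  , parkingPartition m , treePosetPartition m , go (#gt≡#lt m) (#neg≡#lt m) (#eq≤#mid m) (#mid≤#neg m) (#big≤#neg m) (sums≡ m)
  where
  go : ∀ {g e l b c d} → g ≡ l → b ≡ l → e ℕ.≤ c → c ℕ.≤ b → d ℕ.≤ b → g ℕ.+ e ℕ.+ l ≡ b ℕ.+ c ℕ.+ d →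
    largest ⟨ g , e , l ⟩ ≡ largest ⟨ b , c , d ⟩ ×
    ((s t : Triple) → s SortedFormOf ⟨ g , e , l ⟩ → t SortedFormOf ⟨ b , c , d ⟩ → s Majorises t)
  go {l = l} refl refl e≤c c≤l d≤l eq =
    trans (top (ℕ.≤-trans e≤c c≤l) ℕ.≤-refl) (sym (top c≤l d≤l)) , majorises c≤l d≤l eq
    where
    top : ∀ {y z} → y ℕ.≤ l → z ℕ.≤ l → l ℕ.⊔ y ℕ.⊔ z ≡ l
    top {y} y≤l z≤l = trans (ℕ.m≥n⇒m⊔n≡m (ℕ.≤-trans z≤l (ℕ.m≤m⊔n l y))) (ℕ.m≥n⇒m⊔n≡m y≤l)
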